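{- Let $n$ and $k$ be positive integers such that $n\ge4k$. Then \[{\rm ot}(n,K_{1,k})=\begin{cases}\left\lfloor\left(\frac{k-1}{2}\right)n\right\rfloor, & \text{for } k\le3,\\[1ex] (k-2)n-\frac{k^2}{2}+\frac32k-1, & \text{for } k\ge4,\end{cases}\] and ${\rm Ot}(n,K_{1,k})$ is the family of ($n$-vertex) graphs consisting of: (1) the empty graph $\overline{K_n}$, if $k=1$; (2) the disjoint union of $\frac n2$ copies of $K_2$ when $n$ is even, and of $\frac{n-1}{2}$ copies of $K_2$ and one $K_1$ when $n$ is odd, if $k=2$; (3) the disjoint unions of cycles (covering all $n$ vertices), if $k=3$; (4) the complete $(k-2,\,n-k+2)$-split graph, if $k\ge4$.
   Context: $K_{1,k}$ is the star with $k$ edges. A complete $(p,q)$-split graph is a graph whose vertex set has a partition $X\cup Y$ with $|X|=p$, $|Y|=q$, $X$ inducing a complete graph $K_p$, $Y$ independent, and all edges between $X$ and $Y$ present. A $2$-coloring $E(K_n)=E(R)\cup E(B)$ is a partition of the edges of $K_n$ into red and blue edges, forming the spanning subgraphs $R$ and $B$; $e(\cdot)$ denotes number of edges. An $(r,b)$-colored copy of a graph $G$ (with $r+b=e(G)$) is a (not necessarily induced) subgraph of $K_n$ isomorphic to $G$ with exactly $r$ red and $b$ blue edges. ${\rm ot}(n,G)$ is the minimum non-negative integer $s$ such that every $2$-coloring $E(K_n)=E(R)\cup E(B)$ with $\min\{e(R),e(B)\}>s$ contains an $(r,b)$-colored copy of $G$ for every pair of integers $r,b\ge0$ with $r+b=e(G)$.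 ${\rm Ot}(n,G)$ is the family (up to isomorphism) of $n$-vertex graphs with exactly ${\rm ot}(n,G)$ edges such that a coloring $E(K_n)=E(R)\cup E(B)$ with $\min\{e(R),e(B)\}={\rm ot}(n,G)$ contains no $(r,b)$-colored copy of $G$ for some pair $r,b\ge0$ with $r+b=e(G)$ if and only if $R$ or $B$ is isomorphic to some $H\in{\rm Ot}(n,G)$. -}

module Defs where

open import Level using (0ℓ)
open import Data.Nat using (ℕ; zero; suc; _+_; _*_; _∸_; _/_; _%_; _⊓_; _≤_; _<_; _≤?_)
import Data.Nat as ℕ
open import Data.Bool using (if_then_else_)
open import Data.Empty using (⊥)
open import Data.Fin using (Fin; zero; suc; toℕ; _<?_; _≟_)
open import Data.Fin.Subset using (Subset; _∈_; _∉_; ∣_∣; ∁)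
open import Data.List using (List; []; _∷_; _++_; [_]; length; lookup; filter; replicate; cartesianProduct; allFin)
open import Data.List.Relation.Unary.All using (All)
open import Data.Product using (Σ; ∃; ∃-syntax; _×_; _,_)
open import Data.Sum using (_⊎_; inj₁; inj₂; swap)
open import Function.Bundles using (_↔_; _↣_; _⇔_; Inverse; Injection)
open import Relation.Binary using (Rel; Symmetric; Irreflexive; Decidable)
open import Relation.Binary.PropositionalEquality using (_≡_; _≢_; refl; sym)
open import Relation.Nullary using (Dec; yes; no; does; ¬_)
open import Relation.Nullary.Decidable using (_×-dec_; _⊎-dec_; ¬?)
open import Relation.Unary using (Pred)

record Graph (V : Set) : Set₁ where
  field
    Adj        : Rel V 0ℓ
    adj?       : Decidable Adj
    adj-sym    : Symmetric Adj
    adj-irrefl : Irreflexive _≡_ Adj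

open Graph public

infix 4 _≅_

record _≅_ {V W : Set} (G : Graph V) (H : Graph W) : Set where
  field
    bij : V ↔ W
    adj : ∀ u v → Adj G u v ⇔ Adj H (Inverse.to bij u) (Inverse.to bij v)

-- Each edge {u , v} is listed once, as the pair with u < v.
edges : ∀ {n} → Graph (Fin n) → List (Fin n × Fin n)
edges {n} G =
  filter (λ (u , v) → (u <? v) ×-dec adj? G u v) (cartesianProduct (allFin n) (allFin n))

e : ∀ {n} → Graph (Fin n) → ℕ
e G = length (edges G)

record Coloring (n : ℕ) : Set₁ where
  field
    R B      : Graph (Fin n)
    covers   : ∀ {u v} → u ≢ v → Adj R u v ⊎ Adj B u v
    disjoint : ∀ {u v} → Adj R u v → ¬ Adj B u v

open Coloring public

-- The number of edges of G that the vertex map f sends to edges of H.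
edgesInto : ∀ {m n} → Graph (Fin m) → (Fin m → Fin n) → Graph (Fin n) → ℕ
edgesInto G f H = length (filter (λ (u , v) → adj? H (f u) (f v)) (edges G))

-- A copy of G in Kₙ is the image of G under an injective vertex map.
record ColoredCopy {m n : ℕ} (r b : ℕ) (G : Graph (Fin m)) (c : Coloring n) : Set where
  field
    embed : Fin m ↣ Fin n
    red   : edgesInto G (Injection.to embed) (R c) ≡ r
    blue  : edgesInto G (Injection.to embed) (B c) ≡ b

-- Every 2-coloring of Kₙ with min{e(R), e(B)} > s contains all colored copies of G.
Forces : ∀ {m} → ℕ → Graph (Fin m) → ℕ → Set₁
Forces n G s =
  (c : Coloring n) → s < e (R c) ⊓ e (B c) →
  ∀ r b → r + b ≡ e G → ColoredCopy r b G c

IsOt : ∀ {m} → ℕ → Graph (Fin m) → ℕ → Set₁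
IsOt n G s = Forces n G s × (∀ t → Forces n G t → s ≤ t)

Family : ℕ → Set₁
Family n = Pred (Graph (Fin n)) 0ℓ

IsOtFamily : ∀ {m} (n : ℕ) → Graph (Fin m) → Family n → Set₁
IsOtFamily n G F = ∃[ s ]
    IsOt n G s
  × (∀ H → F H → e H ≡ s)
  × ((c : Coloring n) → e (R c) ⊓ e (B c) ≡ s →
      (∃[ r ] ∃[ b ] r + b ≡ e G × ¬ ColoredCopy r b G c)
        ⇔ (∃[ H ] F H × (R c ≅ H ⊎ B c ≅ H)))

SameUpToIso : ∀ {n} → Family n → Family n → Set₁
SameUpToIso F F′ =
    (∀ H → F H → ∃[ H′ ] F′ H′ × H ≅ H′)
  × (∀ H′ → F′ H′ → ∃[ H ] F H × H′ ≅ H)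

-- K_{1,k}, with center zero.
star : (k : ℕ) → Graph (Fin (suc k))
star k = record
  { Adj        = λ u v → (u ≡ zero × v ≢ zero) ⊎ (v ≡ zero × u ≢ zero)
  ; adj?       = λ u v → ((u ≟ zero) ×-dec ¬? (v ≟ zero)) ⊎-dec ((v ≟ zero) ×-dec ¬? (u ≟ zero))
  ; adj-sym    = swap
  ; adj-irrefl = λ { refl (inj₁ (p , q)) → q p ; refl (inj₂ (p , q)) → q p }
  }

emptyGraph : (n : ℕ) → Graph (Fin n)
emptyGraph n = record
  { Adj        = λ _ _ → ⊥
  ; adj?       = λ _ _ → no λ ()
  ; adj-sym    = λ ()
  ; adj-irrefl = λ _ ()
  }

complete : (n : ℕ) → Graph (Fin n)
complete n = record
  { Adj        = _≢_
  ; adj?       = λ u v → ¬? (u ≟ v)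
  ; adj-sym    = λ p q → p (sym q)
  ; adj-irrefl = λ p q → q p
  }

-- j follows i in the cyclic order 0, 1, …, n - 1, 0.
Next : ∀ {n} → Fin n → Fin n → Set
Next {n} i j = toℕ j ≡ suc (toℕ i) ⊎ (toℕ j ≡ 0 × suc (toℕ i) ≡ n)

next? : ∀ {n} (i j : Fin n) → Dec (Next i j)
next? {n} i j = (toℕ j ℕ.≟ suc (toℕ i)) ⊎-dec ((toℕ j ℕ.≟ 0) ×-dec (suc (toℕ i) ℕ.≟ n))

-- The cycle Cₙ for n ≥ 3; the conjunct i ≢ j excludes only the loop that n = 1 would give.
cycle : (n : ℕ) → Graph (Fin n)
cycle n = record
  { Adj        = λ i j → i ≢ j × (Next i j ⊎ Next j i)
  ; adj?       = λ i j → ¬? (i ≟ j) ×-dec (next? i j ⊎-dec next? j i)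
  ; adj-sym    = λ (p , q) → (λ eq → p (sym eq)) , swap q
  ; adj-irrefl = λ eq (p , _) → p eq
  }

data ⨄Adj {m : ℕ} {V : Fin m → Set} (G : ∀ i → Graph (V i)) : Rel (Σ (Fin m) V) 0ℓ where
  within : ∀ {i} {u v : V i} → Adj (G i) u v → ⨄Adj G (i , u) (i , v)

⨄ : ∀ {m} {V : Fin m → Set} → (∀ i → Graph (V i)) → Graph (Σ (Fin m) V)
⨄ {m} {V} G = record
  { Adj        = ⨄Adj G
  ; adj?       = dec
  ; adj-sym    = λ { (within a) → within (adj-sym (G _) a) }
  ; adj-irrefl = λ { refl (within a) → adj-irrefl (G _) refl a }
  }
  where
  dec : Decidable (⨄Adj G)
  dec (i , u) (j , v) with i ≟ j
  ... | no i≢j = no λ { (within _) → i≢j refl }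
  ... | yes refl with adj? (G i) u v
  ...   | yes a = yes (within a)
  ...   | no ¬a = no λ { (within a) → ¬a a }

-- For a list of orders n₁, …, nₘ, the disjoint union of the graphs G n₁, …, G nₘ.
disjointUnion : (G : ∀ n → Graph (Fin n)) (ns : List ℕ) →
                Graph (Σ (Fin (length ns)) λ i → Fin (lookup ns i))
disjointUnion G ns = ⨄ λ i → G (lookup ns i)

IsCompleteSplit : ∀ {n} (p q : ℕ) → Graph (Fin n) → Set
IsCompleteSplit {n} p q G = ∃[ X ]
    ∣ X ∣ ≡ p
  × ∣ ∁ X ∣ ≡ q
  × (∀ {u v} → u ∈ X → v ∈ X → u ≢ v → Adj G u v)
  × (∀ {u v} → u ∉ X → v ∉ X → ¬ Adj G u v)
  × (∀ {u v} → u ∈ X → v ∉ X → Adj G u v)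

-- In the second branch, (k - 2) n - k²/2 + 3k/2 - 1 is written as
-- (k - 2) n - (k² - 3k + 2)/2.  The division is exact since
-- k² - 3k + 2 = (k - 1)(k - 2), and for n ≥ 4k ≥ 16 no subtraction truncates.
otStar : ℕ → ℕ → ℕ
otStar n k =
  if does (k ≤? 3)
  then ((k ∸ 1) * n) / 2
  else ((k ∸ 2) * n ∸ (k * k ∸ 3 * k + 2) / 2)

OtStar : (n k : ℕ) → Family n
OtStar n 0 H = ⊥
OtStar n 1 H = H ≅ emptyGraph n
OtStar n 2 H =
    (n % 2 ≡ 0 × H ≅ disjointUnion complete (replicate (n / 2) 2))
  ⊎ (n % 2 ≡ 1 × H ≅ disjointUnion complete (replicate ((n ∸ 1) / 2) 2 ++ [ 1 ]))
OtStar n 3 H = ∃[ ns ] All (3 ≤_) ns × H ≅ disjointUnion cycle ns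
OtStar n k@(suc (suc (suc (suc _)))) H = IsCompleteSplit (k ∸ 2) (n ∸ k + 2) H

{-# OPTIONS --safe #-}
module Submission where

-- If no vertex is the center of an (r , b)-colored star, then every vertex has red degree below r
-- or blue degree below b.  If r = 0 or b = 0, one color class has maximum degree below k, hence at
-- most (k - 1)n/2 edges; with equality up to rounding it is empty, a maximum matching or 2-regular
-- for k = 1, 2, 3, while for k ≥ 4 it is too small.  Otherwise let x vertices have red degree below
-- r and let the other y vertices have blue degree below b, where by symmetry y ≤ x.  Counting the
-- edges between the two sets gives xy ≤ x(r - 1) + y(b - 1), so y ≤ k - 2.  Then
-- 2e(R) ≤ x(r - 1) + y(n - 1) is largest exactly when b = 1 and y = k - 2, that is, when R is a
-- complete split graph.

open import Defs
open import Data.Nat using (ℕ; _*_; _≤_)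
open import Data.Product using (_×_)
open import Function.Bundles using (_⇔_)

open import Data.Bool using (if_then_else_)
open import Data.Fin using (Fin; zero; suc; toℕ; _≟_; fromℕ<; inject≤; _↑ˡ_; _↑ʳ_; splitAt)
import Data.Fin as Fin
import Data.Fin.Properties as Fin
open import Data.Fin.Subset as Subset using (Subset; inside; outside; ∣_∣; _∈_; _∉_)
open import Data.Fin.Subset.Properties using (_∈?_; ∣⊥∣≡0; ∣∁p∣≡n∸∣p∣)
open import Data.List using (List; []; _∷_; _++_; [_]; length; lookup; filter; map; tabulate; cartesianProduct; allFin; replicate)
open import Data.List.Membership.Propositional.Properties using (∈-lookup)
open import Data.List.Properties using (length-++; filter-++; map-tabulate; ++-identityʳ)
open import Data.List.Relation.Unary.All as All using (All; []; _∷_)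
open import Data.Nat using (zero; suc; _+_; _∸_; _/_; _⊓_; _<_; _≤?_; _<?_; z≤n; s≤s)
import Data.Nat as ℕ
open import Data.Nat.Divisibility using (divides)
open import Data.Nat.DivMod using (m*n/n≡m; m*n%n≡0; [m+kn]%n≡m%n; m/n≤m; /-monoˡ-≤; +-distrib-/-∣ʳ)
open import Data.Nat.Induction using (<-rec)
open import Data.Nat.Properties hiding (_≟_)
open import Data.Nat.Tactic.RingSolver using (solve-∀)
open import Data.Product using (Σ; ∃; ∃-syntax; _,_; proj₁; proj₂)
open import Data.Sum using (_⊎_; inj₁; inj₂; swap; map₂; [_,_]′)
import Data.Vec as Vec
import Data.Vec.Properties as Vec
open import Function using (_∘_; id)
open import Function.Bundles using (_↔_; _↣_; Inverse; Injection; Equivalence; mk⇔; mk↣; mk↔ₛ′)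
import Function.Construct.Composition as Comp
open import Function.Construct.Composition using (_↔-∘_)
open import Function.Construct.Identity using (↔-id)
open import Function.Construct.Symmetry using (↔-sym)
open import Function.Definitions using (Injective)
open import Level using (0ℓ)
open import Relation.Binary.Definitions using (tri<; tri≈; tri>)
open import Relation.Binary.PropositionalEquality hiding ([_])
open import Relation.Nullary using (Dec; yes; no; does; ¬_; contradiction)
open import Relation.Nullary.Decidable using (_×-dec_; _⊎-dec_; ¬?; dec-true; toSum)
open import Relation.Unary using (Pred; Decidable)

open import Algebra.Properties.Semiring.Sum +-*-semiring
  using (sum; sum-cong-≗; ∑-distrib-+; ∑-comm; sum-permute; *-distribˡ-sum; *-distribʳ-sum)

-- The hypothesis `4 * k ≤ n` acts in two places. For `k ≥ 4` it puts the degree sum `(k - 1) n` of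
-- the case `r = 0` or `b = 0` below the degree sum of the split graph. It also keeps `otStar n k`
-- below half of all edges, so that a color class with exactly that many edges is the smaller one; a
-- single graph can then be tested against the family through the coloring that has it as red class.
-- The estimate of the mixed case is kept doubled and free of subtraction: with `K = k - 2` and
-- `n = M + 1` it reads `2 e(R) + K * K + slack ≤ 2 K M + K`, where `slack` is a sum of products
-- that vanishes only in the extremal configuration. One identity thus yields both the bound and its
-- equality case. For `k = 2` and `k = 3` the bound stays below the extremal number, so the mixed
-- case contributes no extremal coloring there. Matchings and 2-regular graphs are described by
-- local conditions on neighbors, because these survive the removal of a component; the explicit
-- disjoint unions then arise by induction on `n`.

private variable
  m n k r b : ℕ
  P Q U V W : Set

-- Indicators, finite sums and counting

𝟙 : Dec P → ℕ
𝟙 d = if does d then 1 else 0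

𝟙-yes : P → (d : Dec P) → 𝟙 d ≡ 1
𝟙-yes p (yes _) = refl
𝟙-yes p (no ¬p) = contradiction p ¬p

𝟙-no : ¬ P → (d : Dec P) → 𝟙 d ≡ 0
𝟙-no ¬p (yes p) = contradiction p ¬p
𝟙-no ¬p (no _)  = refl

𝟙≤1 : (d : Dec P) → 𝟙 d ≤ 1
𝟙≤1 (yes _) = ≤-refl
𝟙≤1 (no _)  = z≤n

𝟙≡1⇒ : (d : Dec P) → 𝟙 d ≡ 1 → P
𝟙≡1⇒ (yes p) _ = p

𝟙-mono : (P → Q) → (d : Dec P) (d′ : Dec Q) → 𝟙 d ≤ 𝟙 d′
𝟙-mono f (yes p) d′ = ≤-reflexive (sym (𝟙-yes (f p) d′))
𝟙-mono f (no _)  d′ = z≤n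

𝟙-cong : P ⇔ Q → (d : Dec P) (d′ : Dec Q) → 𝟙 d ≡ 𝟙 d′
𝟙-cong P⇔Q d d′ =
  ≤-antisym (𝟙-mono (Equivalence.to P⇔Q) d d′) (𝟙-mono (Equivalence.from P⇔Q) d′ d)

𝟙-complement : (d : Dec P) → 𝟙 d + 𝟙 (¬? d) ≡ 1
𝟙-complement (yes _) = refl
𝟙-complement (no _)  = refl

sum-const : ∀ n c → sum {n} (λ _ → c) ≡ n * c
sum-const zero    c = refl
sum-const (suc n) c = cong (c +_) (sum-const n c)

sum-mono : {f g : Fin n → ℕ} → (∀ i → f i ≤ g i) → sum f ≤ sum g
sum-mono {n = zero}  f≤g = z≤n
sum-mono {n = suc n} f≤g = +-mono-≤ (f≤g zero) (sum-mono (f≤g ∘ suc))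

-- The source of the degree-by-degree equality cases: a termwise bound whose total is attained is
-- attained in every term.
sum-mono-tight : {f g : Fin n → ℕ} → (∀ i → f i ≤ g i) → sum g ≤ sum f → ∀ i → f i ≡ g i
sum-mono-tight {n = suc n} {f} {g} f≤g ∑g≤∑f = λ where
    zero    → ≤-antisym (f≤g zero) head≤
    (suc i) → sum-mono-tight (f≤g ∘ suc) tail≤ i
  where
  head≤ : g zero ≤ f zero
  head≤ = +-cancelʳ-≤ _ _ _ (≤-trans ∑g≤∑f (+-monoʳ-≤ (f zero) (sum-mono (f≤g ∘ suc))))
  tail≤ : sum (g ∘ suc) ≤ sum (f ∘ suc)
  tail≤ = +-cancelˡ-≤ (g zero) _ _ (≤-trans ∑g≤∑f (+-monoˡ-≤ _ (f≤g zero)))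

count : {P : Pred (Fin n) 0ℓ} → Decidable P → ℕ
count P? = sum (λ i → 𝟙 (P? i))

-- Serves two purposes: leaves of a star are chosen from a neighborhood of known size, and a vertex
-- subset becomes the vertex set `Fin m` of a smaller graph.
record Enumeration {n} (P : Pred (Fin n) 0ℓ) (m : ℕ) : Set where
  field
    at         : Fin m → Fin n
    injective  : Injective _≡_ _≡_ at
    sound      : ∀ i → P (at i)
    exhaustive : ∀ {v} → P v → ∃[ i ] at i ≡ v

enumerate : {P : Pred (Fin n) 0ℓ} (P? : Decidable P) → Enumeration P (count P?)
enumerate {zero} P? = record
  { at = λ () ; injective = λ {} ; sound = λ () ; exhaustive = λ {} }
enumerate {suc n} P? with enumerate (P? ∘ suc) | P? zero
... | E | yes p = record
  { at         = λ { zero → zero ; (suc i) → suc (at i) }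
  ; injective  = λ { {zero} {zero} _ → refl
                   ; {suc i} {suc j} eq → cong suc (injective (Fin.suc-injective eq)) }
  ; sound      = λ { zero → p ; (suc i) → sound i }
  ; exhaustive = λ { {zero} _ → zero , refl
                   ; {suc v} q → let i , eq = exhaustive q in suc i , cong suc eq }
  } where open Enumeration E
... | E | no ¬p = record
  { at         = suc ∘ at
  ; injective  = injective ∘ Fin.suc-injective
  ; sound      = sound
  ; exhaustive = λ { {zero} q → contradiction q ¬p
                   ; {suc v} q → let i , eq = exhaustive q in i , cong suc eq }
  } where open Enumeration E

injection⇒≤count : {P : Pred (Fin n) 0ℓ} (P? : Decidable P) {g : Fin r → Fin n} →
  Injective _≡_ _≡_ g → (∀ i → P (g i)) → r ≤ count P?
injection⇒≤count P? {g} g-inj Pg = Fin.injective⇒≤ {f = index} index-injective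
  where
  open Enumeration (enumerate P?)
  index = λ i → proj₁ (exhaustive (Pg i))
  index-injective : Injective _≡_ _≡_ index
  index-injective {i} {j} eq = g-inj (trans (sym (proj₂ (exhaustive (Pg i))))
                                     (trans (cong at eq) (proj₂ (exhaustive (Pg j)))))

≤count⇒injection : {P : Pred (Fin n) 0ℓ} (P? : Decidable P) → r ≤ count P? →
  ∃[ g ] Injective _≡_ _≡_ g × (∀ (i : Fin r) → P (g i))
≤count⇒injection P? r≤ =
  (λ i → at (inject≤ i r≤)) , (λ eq → Fin.inject≤-injective r≤ r≤ _ _ (injective eq)) , λ i → sound _
  where open Enumeration (enumerate P?)

count≤1 : {P : Pred (Fin n) 0ℓ} (P? : Decidable P) → (∀ {u v} → P u → P v → u ≡ v) → count P? ≤ 1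
count≤1 P? unique = ≮⇒≥ λ 1<c →
  let g , g-inj , Pg = ≤count⇒injection P? 1<c
  in contradiction (g-inj {zero} {suc zero} (unique (Pg zero) (Pg (suc zero)))) λ ()

count-∀ : {P : Pred (Fin n) 0ℓ} (P? : Decidable P) → (∀ v → P v) → count P? ≡ n
count-∀ {n} P? all = trans (sum-cong-≗ (λ v → 𝟙-yes (all v) (P? v))) (trans (sum-const n 1) (*-identityʳ n))

count-∄ : {P : Pred (Fin n) 0ℓ} (P? : Decidable P) → (∀ v → ¬ P v) → count P? ≡ 0
count-∄ {n} P? none = trans (sum-cong-≗ (λ v → 𝟙-no (none v) (P? v))) (trans (sum-const n 0) (*-zeroʳ n))

count-cong : {P Q : Pred (Fin n) 0ℓ} (P? : Decidable P) (Q? : Decidable Q) → (∀ v → P v ⇔ Q v) → count P? ≡ count Q?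
count-cong P? Q? P⇔Q = sum-cong-≗ λ v → 𝟙-cong (P⇔Q v) (P? v) (Q? v)

count-≟ : (v : Fin n) → count (v ≟_) ≡ 1
count-≟ v = ≤-antisym (count≤1 (v ≟_) (λ p q → trans (sym p) q))
  (injection⇒≤count (v ≟_) {λ (_ : Fin 1) → v} (λ { {zero} {zero} _ → refl }) (λ _ → refl))

count-complement : {P : Pred (Fin n) 0ℓ} (P? : Decidable P) → count P? + count (¬? ∘ P?) ≡ n
count-complement {n} P? = begin
  count P? + count (¬? ∘ P?)                    ≡⟨ ∑-distrib-+ (λ v → 𝟙 (P? v)) _ ⟨
  sum {n} (λ v → 𝟙 (P? v) + 𝟙 (¬? (P? v)))      ≡⟨ sum-cong-≗ {n} (λ v → 𝟙-complement (P? v)) ⟩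
  sum {n} (λ _ → 1)                             ≡⟨ trans (sum-const n 1) (*-identityʳ n) ⟩
  n                                             ∎
  where open ≡-Reasoning

count-splitAt : ∀ r {b} {P : Pred (Fin (r + b)) 0ℓ} (P? : Decidable P) →
  count P? ≡ count (λ i → P? (i ↑ˡ b)) + count (λ j → P? (r ↑ʳ j))
count-splitAt zero    P? = refl
count-splitAt (suc r) P? =
  trans (cong (𝟙 (P? zero) +_) (count-splitAt r (P? ∘ suc))) (sym (+-assoc (𝟙 (P? zero)) _ _))

module _ {A : Set} {P : Pred A 0ℓ} (P? : Decidable P) where

  length-filter-tabulate : ∀ {n} (f : Fin n → A) →
    length (filter P? (tabulate f)) ≡ count (λ i → P? (f i))
  length-filter-tabulate {zero}  f = refl
  length-filter-tabulate {suc n} f with P? (f zero)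
  ... | yes _ = cong suc (length-filter-tabulate (f ∘ suc))
  ... | no  _ = length-filter-tabulate (f ∘ suc)

  length-filter-filter : {Q : Pred A 0ℓ} (Q? : Decidable Q) → ∀ xs →
    length (filter Q? (filter P? xs)) ≡ length (filter (λ x → P? x ×-dec Q? x) xs)
  length-filter-filter Q? []       = refl
  length-filter-filter Q? (x ∷ xs) with P? x
  ... | no _ = length-filter-filter Q? xs
  ... | yes _ with Q? x
  ...   | yes _ = cong suc (length-filter-filter Q? xs)
  ...   | no _  = length-filter-filter Q? xs

length-filter-cartesianProduct : ∀ {A B : Set} {P : Pred (A × B) 0ℓ} (P? : Decidable P)
  (f : Fin m → A) (g : Fin n → B) →
  length (filter P? (cartesianProduct (tabulate f) (tabulate g)))
    ≡ sum (λ i → count (λ j → P? (f i , g j)))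
length-filter-cartesianProduct {zero}  P? f g = refl
length-filter-cartesianProduct {suc m} P? f g = begin
  length (filter P? (map (f zero ,_) (tabulate g) ++ rest))
    ≡⟨ cong (λ row → length (filter P? (row ++ rest))) (map-tabulate g (f zero ,_)) ⟩
  length (filter P? (tabulate ((f zero ,_) ∘ g) ++ rest))
    ≡⟨ cong length (filter-++ P? (tabulate ((f zero ,_) ∘ g)) rest) ⟩
  length (filter P? (tabulate ((f zero ,_) ∘ g)) ++ filter P? rest)
    ≡⟨ length-++ (filter P? (tabulate ((f zero ,_) ∘ g))) ⟩
  length (filter P? (tabulate ((f zero ,_) ∘ g))) + length (filter P? rest)
    ≡⟨ cong₂ _+_ (length-filter-tabulate P? ((f zero ,_) ∘ g)) (length-filter-cartesianProduct P? (f ∘ suc) g) ⟩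
  _ ∎
  where
  open ≡-Reasoning
  rest = cartesianProduct (tabulate (f ∘ suc)) (tabulate g)

-- Degrees and edge counts

deg : Graph (Fin n) → Fin n → ℕ
deg G v = count (adj? G v)

e≡sum : (G : Graph (Fin n)) → e G ≡ sum (λ u → count λ v → (u Fin.<? v) ×-dec adj? G u v)
e≡sum G = length-filter-cartesianProduct (λ (u , v) → (u Fin.<? v) ×-dec adj? G u v) id id

-- Of two copies of the sum over pairs `u < v`, one is transposed; by trichotomy the two terms at an
-- ordered pair add up to its adjacency indicator.
handshake : (G : Graph (Fin n)) → 2 * e G ≡ sum (deg G)
handshake {n} G = begin
  2 * e G                                                       ≡⟨ cong (e G +_) (+-identityʳ (e G)) ⟩
  e G + e G                                                     ≡⟨ cong₂ _+_ (e≡sum G) (e≡sum G) ⟩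
  sum {n} (λ u → sum (up u)) + sum {n} (λ u → sum (up u))       ≡⟨ cong (sum {n} (λ u → sum (up u)) +_) (∑-comm up) ⟩
  sum {n} (λ u → sum (up u)) + sum {n} (λ u → sum {n} (λ v → up v u))
    ≡⟨ ∑-distrib-+ {n} (λ u → sum (up u)) _ ⟨
  sum {n} (λ u → sum (up u) + sum {n} (λ v → up v u))           ≡⟨ sum-cong-≗ {n} (λ u → sym (∑-distrib-+ {n} (up u) _)) ⟩
  sum {n} (λ u → sum {n} (λ v → up u v + up v u))               ≡⟨ sum-cong-≗ {n} (λ u → sum-cong-≗ {n} (merge u)) ⟩
  sum (deg G)                                                   ∎
  where
  open ≡-Reasoning
  up : Fin n → Fin n → ℕ
  up u v = 𝟙 ((u Fin.<? v) ×-dec adj? G u v)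
  merge : ∀ u v → up u v + up v u ≡ 𝟙 (adj? G u v)
  merge u v with Fin.<-cmp u v
  ... | tri< u<v _ v≮u = trans (cong₂ _+_
          (𝟙-cong (mk⇔ proj₂ (u<v ,_)) ((u Fin.<? v) ×-dec adj? G u v) (adj? G u v))
          (𝟙-no (v≮u ∘ proj₁) ((v Fin.<? u) ×-dec adj? G v u))) (+-identityʳ _)
  ... | tri≈ _ refl _ = trans (cong₂ _+_ loop loop) (sym (𝟙-no (adj-irrefl G refl) (adj? G u u)))
    where loop = 𝟙-no (adj-irrefl G refl ∘ proj₂) ((u Fin.<? u) ×-dec adj? G u u)
  ... | tri> u≮v _ v<u = cong₂ _+_
          (𝟙-no (u≮v ∘ proj₁) ((u Fin.<? v) ×-dec adj? G u v))
          (𝟙-cong (mk⇔ (adj-sym G ∘ proj₂) (λ a → v<u , adj-sym G a)) ((v Fin.<? u) ×-dec adj? G v u) (adj? G u v))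

-- The center is `zero`, the least vertex, so every edge of the star is listed in row `zero` and all
-- other rows are empty.
edgesInto-star : ∀ k (f : Fin (suc k) → Fin n) (H : Graph (Fin n)) →
  edgesInto (star k) f H ≡ count (λ j → adj? H (f zero) (f (suc j)))
edgesInto-star k f H = begin
  edgesInto (star k) f H
    ≡⟨ length-filter-filter P? Q? (cartesianProduct (allFin (suc k)) (allFin (suc k))) ⟩
  length (filter PQ? (cartesianProduct (allFin (suc k)) (allFin (suc k))))
    ≡⟨ length-filter-cartesianProduct PQ? id id ⟩
  sum (λ u → count (λ v → PQ? (u , v)))
    ≡⟨ cong₂ _+_ (cong₂ _+_ (𝟙-no (λ { ((() , _) , _) }) (PQ? (zero , zero)))
                            (count-cong (λ j → PQ? (zero , suc j)) (λ j → adj? H (f zero) (f (suc j)))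
                              λ j → mk⇔ proj₂ ((s≤s z≤n , inj₁ (refl , λ ())) ,_)))
                 (trans (sum-cong-≗ (λ i → count-∄ (λ v → PQ? (suc i , v)) (noRow i)))
                        (trans (sum-const k 0) (*-zeroʳ k))) ⟩
  count (λ j → adj? H (f zero) (f (suc j))) + 0
    ≡⟨ +-identityʳ _ ⟩
  count (λ j → adj? H (f zero) (f (suc j))) ∎
  where
  open ≡-Reasoning
  Q? = λ ((u , v) : Fin (suc k) × Fin (suc k)) → adj? H (f u) (f v)
  P? = λ ((u , v) : Fin (suc k) × Fin (suc k)) → (u Fin.<? v) ×-dec adj? (star k) u v
  PQ? = λ ((u , v) : Fin (suc k) × Fin (suc k)) →
    ((u Fin.<? v) ×-dec adj? (star k) u v) ×-dec adj? H (f u) (f v)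
  noRow : ∀ i v → ¬ ((suc i Fin.< v × Adj (star k) (suc i) v) × Adj H (f (suc i)) (f v))
  noRow i zero    ((() , _) , _)
  noRow i (suc v) ((_ , inj₁ (() , _)) , _)
  noRow i (suc v) ((_ , inj₂ (() , _)) , _)

e-star : ∀ k → e (star k) ≡ k
e-star k = begin
  e (star k)                                        ≡⟨ e≡sum (star k) ⟩
  sum (λ u → count (E? u))
    ≡⟨ cong₂ _+_ (cong₂ _+_ (𝟙-no (λ { (() , _) }) (E? zero zero))
                            (count-∀ (λ j → E? zero (suc j)) (λ j → s≤s z≤n , inj₁ (refl , λ ()))))
                 (trans (sum-cong-≗ (λ i → count-∄ (E? (suc i)) (noRow i)))
                        (trans (sum-const k 0) (*-zeroʳ k))) ⟩
  k + 0                                             ≡⟨ +-identityʳ k ⟩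
  k                                                 ∎
  where
  open ≡-Reasoning
  E? = λ (u v : Fin (suc k)) → (u Fin.<? v) ×-dec adj? (star k) u v
  noRow : ∀ i v → ¬ (suc i Fin.< v × Adj (star k) (suc i) v)
  noRow i zero    (() , _)
  noRow i (suc v) (_ , inj₁ (() , _))
  noRow i (suc v) (_ , inj₂ (() , _))

-- Stars and degrees

deg-red+blue : (c : Coloring n) (v : Fin n) → suc (deg (R c) v + deg (B c) v) ≡ n
deg-red+blue {n} c v = begin
  1 + (deg (R c) v + deg (B c) v)
    ≡⟨ cong₂ _+_ (count-≟ v) (∑-distrib-+ {n} (λ w → 𝟙 (adj? (R c) v w)) _) ⟨
  count (v ≟_) + sum {n} (λ w → 𝟙 (adj? (R c) v w) + 𝟙 (adj? (B c) v w))
    ≡⟨ ∑-distrib-+ {n} (λ w → 𝟙 (v ≟ w)) _ ⟨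
  sum {n} (λ w → 𝟙 (v ≟ w) + (𝟙 (adj? (R c) v w) + 𝟙 (adj? (B c) v w)))
    ≡⟨ sum-cong-≗ {n} one ⟩
  sum {n} (λ _ → 1)
    ≡⟨ trans (sum-const n 1) (*-identityʳ n) ⟩
  n ∎
  where
  open ≡-Reasoning
  one : ∀ w → 𝟙 (v ≟ w) + (𝟙 (adj? (R c) v w) + 𝟙 (adj? (B c) v w)) ≡ 1
  one w with v ≟ w | adj? (R c) v w | adj? (B c) v w
  ... | yes refl | yes a | _     = contradiction a (adj-irrefl (R c) refl)
  ... | yes refl | no _  | yes a = contradiction a (adj-irrefl (B c) refl)
  ... | yes refl | no _  | no _  = refl
  ... | no _     | yes a | yes a′ = contradiction a′ (disjoint c a)
  ... | no _     | yes _ | no _  = refl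
  ... | no _     | no _  | yes _ = refl
  ... | no v≢w   | no ¬a | no ¬a′ = contradiction (covers c v≢w) [ ¬a , ¬a′ ]′

-- The degree form of having no `(r , b)`-colored star; `copy⊎avoids` and `avoids⇒¬copy` translate
-- in both directions.
Avoids : Coloring n → ℕ → ℕ → Set
Avoids c r b = ∀ v → deg (R c) v < r ⊎ deg (B c) v < b

-- The first `r` leaves are red neighbors of `v` and the last `b` are blue ones; disjointness of the
-- colors keeps the two groups apart.
star-at : (c : Coloring n) (v : Fin n) → r ≤ deg (R c) v → b ≤ deg (B c) v →
  ColoredCopy r b (star (r + b)) c
star-at {n} {r} {b} c v r≤ b≤
  with g , g-inj , Rg ← ≤count⇒injection (adj? (R c) v) r≤
     | h , h-inj , Bh ← ≤count⇒injection (adj? (B c) v) b≤ = record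
  { embed = mk↣ {to = f} f-inj
  ; red   = trans (edgesInto-star (r + b) f (R c)) (trans (count-splitAt r (λ j → adj? (R c) v (leaf j)))
              (trans (cong₂ _+_ (count-∀ (λ i → adj? (R c) v (leaf (i ↑ˡ b))) R-left)
                                (count-∄ (λ i → adj? (R c) v (leaf (r ↑ʳ i))) λ i a → disjoint c a (B-right i)))
                     (+-identityʳ r)))
  ; blue  = trans (edgesInto-star (r + b) f (B c)) (trans (count-splitAt r (λ j → adj? (B c) v (leaf j)))
              (cong₂ _+_ (count-∄ (λ i → adj? (B c) v (leaf (i ↑ˡ b))) λ i → disjoint c (R-left i))
                         (count-∀ (λ i → adj? (B c) v (leaf (r ↑ʳ i))) B-right)))
  }
  where
  pick : Fin r ⊎ Fin b → Fin n
  pick = [ g , h ]′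
  leaf : Fin (r + b) → Fin n
  leaf = pick ∘ splitAt r
  f : Fin (suc (r + b)) → Fin n
  f zero    = v
  f (suc j) = leaf j
  R-left : ∀ i → Adj (R c) v (leaf (i ↑ˡ b))
  R-left i = subst (Adj (R c) v ∘ pick) (sym (Fin.splitAt-↑ˡ r i b)) (Rg i)
  B-right : ∀ i → Adj (B c) v (leaf (r ↑ʳ i))
  B-right i = subst (Adj (B c) v ∘ pick) (sym (Fin.splitAt-↑ʳ r b i)) (Bh i)
  pick-inj : ∀ {s t} → pick s ≡ pick t → s ≡ t
  pick-inj {inj₁ i} {inj₁ j} eq = cong inj₁ (g-inj eq)
  pick-inj {inj₁ i} {inj₂ j} eq = contradiction (Bh j) (disjoint c (subst (Adj (R c) v) eq (Rg i)))
  pick-inj {inj₂ i} {inj₁ j} eq = contradiction (Bh i) (disjoint c (subst (Adj (R c) v) (sym eq) (Rg j)))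
  pick-inj {inj₂ i} {inj₂ j} eq = cong inj₂ (h-inj eq)
  pick-≢ : ∀ s → pick s ≢ v
  pick-≢ (inj₁ i) eq = adj-irrefl (R c) (sym eq) (Rg i)
  pick-≢ (inj₂ i) eq = adj-irrefl (B c) (sym eq) (Bh i)
  f-inj : ∀ {i j} → f i ≡ f j → i ≡ j
  f-inj {zero}  {zero}  eq = refl
  f-inj {zero}  {suc j} eq = contradiction (sym eq) (pick-≢ (splitAt r j))
  f-inj {suc i} {zero}  eq = contradiction eq (pick-≢ (splitAt r i))
  f-inj {suc i} {suc j} eq = cong suc (trans (sym (Fin.join-splitAt r b i))
    (trans (cong (Fin.join r b) (pick-inj {splitAt r i} {splitAt r j} eq)) (Fin.join-splitAt r b j)))

edgesInto-star≤deg : (f : Fin (suc k) ↣ Fin n) (H : Graph (Fin n)) →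
  edgesInto (star k) (Injection.to f) H ≤ deg H (Injection.to f zero)
edgesInto-star≤deg {k} f H = subst (_≤ deg H (to zero)) (sym (edgesInto-star k to H))
  (injection⇒≤count (adj? H (to zero)) {to ∘ suc ∘ at} (injective ∘ Fin.suc-injective ∘ Injection.injective f) sound)
  where
  to = Injection.to f
  open Enumeration (enumerate (λ j → adj? H (to zero) (to (suc j))))

avoids⇒¬copy : {c : Coloring n} → Avoids c r b → ¬ ColoredCopy r b (star k) c
avoids⇒¬copy {c = c} avoids copy = [ ≤⇒≯ r≤ , ≤⇒≯ b≤ ]′ (avoids (Injection.to embed zero))
  where
  open ColoredCopy copy
  r≤ = subst (_≤ deg (R c) (Injection.to embed zero)) red (edgesInto-star≤deg embed (R c))
  b≤ = subst (_≤ deg (B c) (Injection.to embed zero)) blue (edgesInto-star≤deg embed (B c))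

copy⊎avoids : (c : Coloring n) → r + b ≡ e (star k) → ColoredCopy r b (star k) c ⊎ Avoids c r b
copy⊎avoids {r = r} {b} {k} c r+b≡ with refl ← trans r+b≡ (e-star k)
  with Fin.any? (λ v → (r ≤? deg (R c) v) ×-dec (b ≤? deg (B c) v))
... | yes (v , r≤ , b≤) = inj₁ (star-at c v r≤ b≤)
... | no none = inj₂ avoids
  where
  avoids : Avoids c r b
  avoids v with r ≤? deg (R c) v
  ... | no r≰  = inj₁ (≰⇒> r≰)
  ... | yes r≤ = inj₂ (≰⇒> λ b≤ → none (v , r≤ , b≤))

-- Isomorphisms and induced subgraphs

≅-refl : {G : Graph V} → G ≅ G
≅-refl = record { bij = ↔-id _ ; adj = λ _ _ → mk⇔ id id }

≅-sym : {G : Graph V} {H : Graph W} → G ≅ H → H ≅ G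
≅-sym {G = G} {H} φ = record
  { bij = ↔-sym bij
  ; adj = λ u v → mk⇔
      (λ a → Equivalence.from (adj (from u) (from v)) (subst₂ (Adj H) (sym (strictlyInverseˡ u)) (sym (strictlyInverseˡ v)) a))
      (λ a → subst₂ (Adj H) (strictlyInverseˡ u) (strictlyInverseˡ v) (Equivalence.to (adj (from u) (from v)) a))
  }
  where
  open _≅_ φ
  open Inverse bij

≅-trans : {G : Graph U} {H : Graph V} {K : Graph W} → G ≅ H → H ≅ K → G ≅ K
≅-trans φ ψ = record
  { bij = ψ .bij ↔-∘ φ .bij
  ; adj = λ u v → Comp.equivalence (φ .adj u v) (ψ .adj _ _)
  }
  where open _≅_

bijection⇒≅ : {G : Graph V} {H : Graph W} (f : V → W) →
  (∀ {u v} → f u ≡ f v → u ≡ v) → (∀ w → ∃[ v ] f v ≡ w) →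
  (∀ u v → Adj G u v ⇔ Adj H (f u) (f v)) → G ≅ H
bijection⇒≅ f f-inj f-surj f-adj = record
  { bij = mk↔ₛ′ f (proj₁ ∘ f-surj) (proj₂ ∘ f-surj) (λ v → f-inj (proj₂ (f-surj (f v))))
  ; adj = f-adj
  }

to-injective : (π : V ↔ W) → ∀ {u v} → Inverse.to π u ≡ Inverse.to π v → u ≡ v
to-injective π {u} {v} eq =
  trans (sym (strictlyInverseʳ u)) (trans (cong from eq) (strictlyInverseʳ v))
  where open Inverse π

module _ {G H : Graph (Fin n)} (φ : G ≅ H) where
  open _≅_ φ
  open Inverse bij using (to)

  deg-≅ : ∀ v → deg G v ≡ deg H (to v)
  deg-≅ v = trans (count-cong (adj? G v) (λ w → adj? H (to v) (to w)) (adj v))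
                  (sym (sum-permute (λ w → 𝟙 (adj? H (to v) w)) bij))

  e-≅ : e G ≡ e H
  e-≅ = *-cancelˡ-≡ (e G) (e H) 2 (begin
    2 * e G                     ≡⟨ handshake G ⟩
    sum (deg G)                 ≡⟨ sum-cong-≗ deg-≅ ⟩
    sum (λ v → deg H (to v))    ≡⟨ sum-permute (deg H) bij ⟨
    sum (deg H)                 ≡⟨ handshake H ⟨
    2 * e H                     ∎)
    where open ≡-Reasoning

count-image : (f : Fin m → Fin n) → Injective _≡_ _≡_ f →
  count (λ v → Fin.any? (λ i → f i ≟ v)) ≡ m
count-image {m} f f-inj = ≤-antisym
  (Fin.injective⇒≤ {f = proj₁ ∘ sound}
    (λ {i} {j} eq → injective (trans (sym (proj₂ (sound i))) (trans (cong f eq) (proj₂ (sound j))))))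
  (injection⇒≤count inImage? f-inj (λ i → i , refl))
  where
  inImage? = λ v → Fin.any? (λ i → f i ≟ v)
  open Enumeration (enumerate inImage?)

induced : Graph W → (V → W) → Graph V
induced G f = record
  { Adj        = λ u v → Adj G (f u) (f v)
  ; adj?       = λ u v → adj? G (f u) (f v)
  ; adj-sym    = adj-sym G
  ; adj-irrefl = λ { refl → adj-irrefl G refl }
  }

-- Two-regular graphs

TwoRegular : Graph V → Set
TwoRegular G = ∀ v → ∃[ a ] ∃[ b ] a ≢ b × Adj G v a × Adj G v b × (∀ {w} → Adj G v w → w ≡ a ⊎ w ≡ b)

-- The image of `f` is a union of components, since no edge leaves it. Removing it is the induction
-- step for both decompositions, into cycles and into edges.
module Peel (G : Graph (Fin n)) (f : Fin m → Fin n) (f-inj : Injective _≡_ _≡_ f)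
            (closed : ∀ i {w} → Adj G (f i) w → ∃[ j ] f j ≡ w) where

  outside? : Decidable (λ v → ¬ (∃[ i ] f i ≡ v))
  outside? v = ¬? (Fin.any? (λ i → f i ≟ v))

  size : ℕ
  size = count outside?

  open Enumeration (enumerate outside?) public

  m+size≡n : m + size ≡ n
  m+size≡n = trans (cong (_+ size) (sym (count-image f f-inj)))
                   (count-complement (λ v → Fin.any? (λ i → f i ≟ v)))

  rest : Graph (Fin size)
  rest = induced G at

  neighbor-outside : ∀ i {w} → Adj G (at i) w → ∃[ j ] at j ≡ w
  neighbor-outside i a = exhaustive λ { (j , refl) → sound i (closed j (adj-sym G a)) }

  rest-regular : TwoRegular G → TwoRegular rest
  rest-regular reg i with a , b , a≢b , va , vb , only ← reg (at i)
    with a′ , refl ← neighbor-outside i va | b′ , refl ← neighbor-outside i vb =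
    a′ , b′ , (λ { refl → a≢b refl }) , va , vb ,
    λ vw → [ inj₁ ∘ injective , inj₂ ∘ injective ]′ (only vw)

  -- No edge joins the image of `f` to the rest, so an isomorphism onto the rest extends by `f` on a
  -- new first summand.
  glue : (K : ∀ n → Graph (Fin n)) {ns : List ℕ} →
    (∀ i j → Adj (K m) i j ⇔ Adj G (f i) (f j)) →
    disjointUnion K ns ≅ rest → disjointUnion K (m ∷ ns) ≅ G
  glue K {ns} f-adj φ = bijection⇒≅ h h-inj h-surj h-adj
    where
    open _≅_ φ
    open Inverse bij
    h : Σ (Fin (suc (length ns))) (λ i → Fin (lookup (m ∷ ns) i)) → Fin n
    h (zero  , j) = f j
    h (suc i , j) = at (to (i , j))
    h-inj : ∀ {u v} → h u ≡ h v → u ≡ v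
    h-inj {zero  , _} {zero  , _} eq = cong (zero ,_) (f-inj eq)
    h-inj {zero  , _} {suc _ , _} eq = contradiction (_ , eq) (sound _)
    h-inj {suc _ , _} {zero  , _} eq = contradiction (_ , sym eq) (sound _)
    h-inj {suc i , u} {suc j , v} eq with refl ← to-injective bij (injective eq) = refl
    h-surj : ∀ w → ∃[ v ] h v ≡ w
    h-surj w with Fin.any? (λ i → f i ≟ w)
    ... | yes (j , eq) = (zero , j) , eq
    ... | no ∉f with i , refl ← exhaustive ∉f with (j , u) ← from i in eq =
      (suc j , u) , cong at (trans (cong to (sym eq)) (strictlyInverseˡ i))
    h-adj : ∀ u v → Adj (disjointUnion K (m ∷ ns)) u v ⇔ Adj G (h u) (h v)
    h-adj (zero  , u) (zero  , v) = mk⇔ (λ { (within a) → Equivalence.to (f-adj u v) a })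
                                        (λ a → within (Equivalence.from (f-adj u v) a))
    h-adj (zero  , u) (suc j , v) = mk⇔ (λ ()) λ a → contradiction (closed u a) (sound _)
    h-adj (suc i , u) (zero  , v) = mk⇔ (λ ()) λ a → contradiction (closed v (adj-sym G a)) (sound _)
    h-adj (suc i , u) (suc j , v) = Comp.equivalence (mk⇔ (λ { (within a) → within a }) (λ { (within a) → within a }))
                                                     (adj (i , u) (j , v))

-- Follows the edges from start without turning back; the first repeated vertex is start itself.
module Walk (G : Graph (Fin n)) (reg : TwoRegular G) (start : Fin n) where

  other : Fin n → Fin n → Fin n
  other v u with a , b , _ ← reg v with u ≟ a
  ... | yes _ = b
  ... | no  _ = a

  module _ {v u} (v~u : Adj G v u) where

    other-≢ : other v u ≢ u
    other-≢ eq with a , b , a≢b , _ ← reg v with u ≟ a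
    ... | yes refl = a≢b (sym eq)
    ... | no u≢a   = u≢a (sym eq)

    other-adj : Adj G v (other v u)
    other-adj with a , b , a≢b , va , vb , _ ← reg v with u ≟ a
    ... | yes _ = vb
    ... | no  _ = va

    only-other : ∀ {w} → Adj G v w → w ≡ u ⊎ w ≡ other v u
    only-other vw with a , b , a≢b , _ , _ , only ← reg v with u ≟ a
    ... | yes refl = only vw
    ... | no u≢a with only v~u
    ...   | inj₁ u≡a  = contradiction u≡a u≢a
    ...   | inj₂ refl = swap (only vw)

  p : ℕ → Fin n
  p 0             = start
  p 1             = proj₁ (reg start)
  p (suc (suc i)) = other (p (suc i)) (p i)

  p-step : ∀ i → Adj G (p i) (p (suc i))
  p-step zero    = let _ , _ , _ , a , _ = reg start in a
  p-step (suc i) = other-adj (adj-sym G (p-step i))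

  p-no-backtrack : ∀ i → p (suc (suc i)) ≢ p i
  p-no-backtrack i = other-≢ (adj-sym G (p-step i))

  p-neighbors : ∀ i {w} → Adj G (p (suc i)) w → w ≡ p i ⊎ w ≡ p (suc (suc i))
  p-neighbors i = only-other (adj-sym G (p-step i))

  Distinct : ℕ → Set
  Distinct t = ∀ {i j} → i < t → j < t → p i ≡ p j → i ≡ j

  Collision : ℕ → Set
  Collision t = Distinct t × ∃[ j ] j < t × p j ≡ p t

  distinct⊎collision : ∀ t → Distinct t ⊎ ∃ Collision
  distinct⊎collision zero = inj₁ λ ()
  distinct⊎collision (suc t) with distinct⊎collision t
  ... | inj₂ c = inj₂ c
  ... | inj₁ d with Fin.any? (λ (j : Fin t) → p (toℕ j) ≟ p t)
  ...   | yes (j , eq) = inj₂ (t , d , toℕ j , Fin.toℕ<n j , eq)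
  ...   | no fresh = inj₁ d′
    where
    unseen : ∀ {j} → j < t → p j ≢ p t
    unseen j<t eq = fresh (fromℕ< j<t , trans (cong p (Fin.toℕ-fromℕ< j<t)) eq)
    d′ : Distinct (suc t)
    d′ {i} {j} (s≤s i≤t) (s≤s j≤t) eq with m≤n⇒m<n∨m≡n i≤t | m≤n⇒m<n∨m≡n j≤t
    ... | inj₁ i<t  | inj₁ j<t  = d i<t j<t eq
    ... | inj₁ i<t  | inj₂ refl = contradiction eq (unseen i<t)
    ... | inj₂ refl | inj₁ j<t  = contradiction (sym eq) (unseen j<t)
    ... | inj₂ refl | inj₂ refl = refl

  collision : ∃ Collision
  collision with distinct⊎collision (suc n)
  ... | inj₂ c = c
  ... | inj₁ d = contradiction
    (Fin.injective⇒≤ {f = p ∘ toℕ {suc n}} (λ {i} {j} eq → Fin.toℕ-injective (d (Fin.toℕ<n i) (Fin.toℕ<n j) eq)))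
    1+n≰n

  -- A vertex met before other than the start already has both of its neighbors on the walk.
  closes : ∀ {t} → Collision (suc t) → p 0 ≡ p (suc t)
  closes (_ , zero , _ , eq) = eq
  closes {t} (d , suc j , s≤s j<t , eq)
    with p-neighbors j (subst (λ v → Adj G v (p t)) (sym eq) (adj-sym G (p-step t)))
  ... | inj₁ t≡j = contradiction (d (n<1+n t) (m<n⇒m<1+n j<t) t≡j) (>⇒≢ j<t)
  ... | inj₂ t≡2+j with m≤n⇒m<n∨m≡n j<t
  ...   | inj₂ refl = contradiction (p-step (suc j)) (adj-irrefl G eq)
  ...   | inj₁ 1+j<t with refl ← d (n<1+n t) (s≤s 1+j<t) t≡2+j =
    contradiction (sym eq) (p-no-backtrack (suc j))

  -- Period 1 would be a loop and period 2 would be a turning back.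
  period : ∃[ m ] Distinct (3 + m) × p 0 ≡ p (3 + m)
  period with collision
  ... | zero , _ , _ , () , _
  ... | 1 , c = contradiction (p-step 0) (adj-irrefl G (closes c))
  ... | 2 , c = contradiction (sym (closes c)) (p-no-backtrack 0)
  ... | suc (suc (suc m)) , c = m , proj₁ c , closes c

  len : ℕ
  len = 3 + proj₁ period

  distinct : Distinct len
  distinct = proj₁ (proj₂ period)

  closed-up : p 0 ≡ p len
  closed-up = proj₂ (proj₂ period)

  Succ : ℕ → ℕ → Set
  Succ i j = j ≡ suc i ⊎ (j ≡ 0 × suc i ≡ len)

  succ-adj : ∀ {i j} → Succ i j → Adj G (p i) (p j)
  succ-adj {i} (inj₁ refl) = p-step i
  succ-adj {i} (inj₂ (refl , refl)) = subst (Adj G (p i)) (sym closed-up) (p-step i)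

  neighbor-on-walk : ∀ i → i < len → ∀ {w} → Adj G (p i) w → ∃[ j ] j < len × p j ≡ w × (Succ i j ⊎ Succ j i)
  -- The start has no predecessor on the walk, so its neighbors are read off at its second
  -- occurrence `p len`.
  neighbor-on-walk zero _ {w} a with p-neighbors (2 + proj₁ period) (subst (λ v → Adj G v w) closed-up a)
  ... | inj₁ refl = _ , n<1+n _ , refl , inj₂ (inj₂ (refl , refl))
  -- The neighbor after `p len` has to be `p 1`: the only alternative, that `p 1` is the vertex
  -- before `p len`, contradicts distinctness.
  ... | inj₂ refl with p-neighbors (2 + proj₁ period) (subst (λ v → Adj G v (p 1)) closed-up (p-step 0))
  ...   | inj₁ 1≡last = contradiction (distinct (s≤s (s≤s z≤n)) (n<1+n _) 1≡last) λ ()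
  ...   | inj₂ 1≡1+len = 1 , s≤s (s≤s z≤n) , 1≡1+len , inj₁ (inj₁ refl)
  neighbor-on-walk (suc i) i<len a with p-neighbors i a
  ... | inj₁ refl = i , <-trans (n<1+n i) i<len , refl , inj₂ (inj₁ refl)
  ... | inj₂ refl with m≤n⇒m<n∨m≡n i<len
  ...   | inj₁ 2+i<len = _ , 2+i<len , refl , inj₁ (inj₁ refl)
  ...   | inj₂ 2+i≡len = 0 , s≤s z≤n , trans closed-up (cong p (sym 2+i≡len)) , inj₁ (inj₂ (refl , 2+i≡len))

  cyc : Fin len → Fin n
  cyc = p ∘ toℕ

  cyc-injective : Injective _≡_ _≡_ cyc
  cyc-injective {i} {j} eq = Fin.toℕ-injective (distinct (Fin.toℕ<n i) (Fin.toℕ<n j) eq)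

  cyc-closed : ∀ i {w} → Adj G (cyc i) w → ∃[ j ] cyc j ≡ w
  cyc-closed i a with j , j<len , eq , _ ← neighbor-on-walk (toℕ i) (Fin.toℕ<n i) a =
    fromℕ< j<len , trans (cong p (Fin.toℕ-fromℕ< j<len)) eq

  cyc-adj : ∀ i j → Adj (cycle len) i j ⇔ Adj G (cyc i) (cyc j)
  cyc-adj i j = mk⇔ (λ { (_ , inj₁ i→j) → succ-adj i→j ; (_ , inj₂ j→i) → adj-sym G (succ-adj j→i) }) back
    where
    back : Adj G (cyc i) (cyc j) → Adj (cycle len) i j
    back a with j′ , j′<len , eq , next ← neighbor-on-walk (toℕ i) (Fin.toℕ<n i) a
      with refl ← distinct j′<len (Fin.toℕ<n j) eq = (λ { refl → adj-irrefl G refl a }) , next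

nothing≅ : (K : ∀ n → Graph (Fin n)) (G : Graph (Fin 0)) → disjointUnion K [] ≅ G
nothing≅ K G = bijection⇒≅ (λ ()) (λ {}) (λ ()) (λ ())

-- The walk from `zero` traces a whole component, because both neighbors of each of its vertices lie
-- on it; peeling off this cycle leaves a smaller 2-regular graph.
twoRegular⇒cycles : (G : Graph (Fin n)) → TwoRegular G →
  ∃[ ns ] All (3 ≤_) ns × disjointUnion cycle ns ≅ G
twoRegular⇒cycles {n} = <-rec Cycles step n
  where
  Cycles : ℕ → Set₁
  Cycles n = (G : Graph (Fin n)) → TwoRegular G → ∃[ ns ] All (3 ≤_) ns × disjointUnion cycle ns ≅ G
  step : ∀ n → (∀ {m} → m < n → Cycles m) → Cycles n
  step zero    rec G reg = [] , [] , nothing≅ cycle G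
  step (suc n) rec G reg =
    let ns , ns≥3 , φ = rec smaller rest (rest-regular reg)
    in len ∷ ns , s≤s (s≤s (s≤s z≤n)) ∷ ns≥3 , glue cycle cyc-adj φ
    where
    open Walk G reg zero
    open Peel G cyc cyc-injective cyc-closed
    smaller : size < suc n
    smaller = subst (suc size ≤_) m+size≡n (+-monoˡ-≤ size (s≤s {n = 2 + proj₁ period} z≤n))

two-neighbors⇒2≤deg : (G : Graph (Fin n)) → ∀ {v a b} → a ≢ b → Adj G v a → Adj G v b → 2 ≤ deg G v
two-neighbors⇒2≤deg G {v} {a} {b} a≢b va vb = injection⇒≤count (adj? G v) {g} g-inj sound
  where
  g : Fin 2 → Fin _
  g zero       = a
  g (suc zero) = b
  g-inj : ∀ {i j} → g i ≡ g j → i ≡ j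
  g-inj {zero}     {zero}     _  = refl
  g-inj {zero}     {suc zero} eq = contradiction eq a≢b
  g-inj {suc zero} {zero}     eq = contradiction (sym eq) a≢b
  g-inj {suc zero} {suc zero} _  = refl
  sound : ∀ i → Adj G v (g i)
  sound zero       = va
  sound (suc zero) = vb

2*n/2≡n : ∀ n → (2 * n) / 2 ≡ n
2*n/2≡n n = trans (cong (_/ 2) (*-comm 2 n)) (m*n/n≡m n 2)

deg≡2⇒twoRegular : (G : Graph (Fin n)) → (∀ v → deg G v ≡ 2) → TwoRegular G
deg≡2⇒twoRegular G deg≡2 v =
  at zero , at (suc zero) , (λ eq → contradiction (injective eq) λ ()) , sound zero , sound (suc zero) , only
  where
  open Enumeration (subst (Enumeration (Adj G v)) (deg≡2 v) (enumerate (adj? G v)))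
  only : ∀ {w} → Adj G v w → w ≡ at zero ⊎ w ≡ at (suc zero)
  only vw with exhaustive vw
  ... | zero     , eq = inj₁ (sym eq)
  ... | suc zero , eq = inj₂ (sym eq)

twoRegular⇒deg≡2 : (G : Graph (Fin n)) → TwoRegular G → ∀ v → deg G v ≡ 2
twoRegular⇒deg≡2 {n} G reg v with a , b , a≢b , va , vb , only ← reg v = begin
  count (adj? G v)                            ≡⟨ sum-cong-≗ split ⟩
  sum {n} (λ w → 𝟙 (a ≟ w) + 𝟙 (b ≟ w))       ≡⟨ ∑-distrib-+ {n} (λ w → 𝟙 (a ≟ w)) _ ⟩
  count (a ≟_) + count (b ≟_)                 ≡⟨ cong₂ _+_ (count-≟ a) (count-≟ b) ⟩
  2                                           ∎
  where
  open ≡-Reasoning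
  split : ∀ w → 𝟙 (adj? G v w) ≡ 𝟙 (a ≟ w) + 𝟙 (b ≟ w)
  split w with a ≟ w | b ≟ w
  ... | yes refl | yes refl = contradiction refl a≢b
  ... | yes refl | no _     = 𝟙-yes va (adj? G v w)
  ... | no _     | yes refl = 𝟙-yes vb (adj? G v w)
  ... | no a≢w   | no b≢w   = 𝟙-no (λ vw → [ a≢w ∘ sym , b≢w ∘ sym ]′ (only vw)) (adj? G v w)

twoRegular⇒e≡n : (G : Graph (Fin n)) → TwoRegular G → e G ≡ n
twoRegular⇒e≡n {n} G reg = *-cancelˡ-≡ (e G) n 2 (begin
  2 * e G         ≡⟨ handshake G ⟩
  sum (deg G)     ≡⟨ sum-cong-≗ (twoRegular⇒deg≡2 G reg) ⟩
  sum {n} (λ _ → 2) ≡⟨ sum-const n 2 ⟩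
  n * 2           ≡⟨ *-comm n 2 ⟩
  2 * n           ∎)
  where open ≡-Reasoning

twoRegular-≅ : {G : Graph V} {H : Graph W} → G ≅ H → TwoRegular H → TwoRegular G
twoRegular-≅ {G = G} {H} φ reg v with a , b , a≢b , va , vb , only ← reg (Inverse.to (_≅_.bij φ) v) =
  from a , from b ,
  (λ eq → a≢b (trans (sym (strictlyInverseˡ a)) (trans (cong to eq) (strictlyInverseˡ b)))) ,
  back va , back vb ,
  λ {w} vw → [ (λ eq → inj₁ (trans (sym (strictlyInverseʳ w)) (cong from eq)))
             , (λ eq → inj₂ (trans (sym (strictlyInverseʳ w)) (cong from eq))) ]′
             (only (Equivalence.to (adj v w) vw))
  where
  open _≅_ φ
  open Inverse bij
  back : ∀ {w} → Adj H (to v) w → Adj G v (from w)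
  back {w} a = Equivalence.from (adj v (from w)) (subst (Adj H (to v)) (sym (strictlyInverseˡ w)) a)

module _ {m′ : ℕ} where
  private
    N = 3 + m′

  next-unique : {i j k : Fin N} → Next i j → Next i k → j ≡ k
  next-unique (inj₁ p)       (inj₁ q)       = Fin.toℕ-injective (trans p (sym q))
  next-unique (inj₂ (p , _)) (inj₂ (q , _)) = Fin.toℕ-injective (trans p (sym q))
  next-unique {j = j} (inj₁ p) (inj₂ (_ , q)) = contradiction (trans p q) (<⇒≢ (Fin.toℕ<n j))
  next-unique {k = k} (inj₂ (_ , q)) (inj₁ p) = contradiction (trans p q) (<⇒≢ (Fin.toℕ<n k))

  prev-unique : {i j k : Fin N} → Next j i → Next k i → j ≡ k
  prev-unique (inj₁ p)       (inj₁ q)       = Fin.toℕ-injective (suc-injective (trans (sym p) q))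
  prev-unique (inj₂ (_ , p)) (inj₂ (_ , q)) = Fin.toℕ-injective (suc-injective (trans p (sym q)))
  prev-unique (inj₁ p) (inj₂ (q , _)) = contradiction (trans (sym p) q) λ ()
  prev-unique (inj₂ (q , _)) (inj₁ p) = contradiction (trans (sym p) q) λ ()

  ∃next : (i : Fin N) → ∃[ j ] Next i j
  ∃next i with m≤n⇒m<n∨m≡n (Fin.toℕ<n i)
  ... | inj₁ i<  = fromℕ< i< , inj₁ (Fin.toℕ-fromℕ< i<)
  ... | inj₂ eq  = zero , inj₂ (refl , eq)

  ∃prev : (i : Fin N) → ∃[ j ] Next j i
  ∃prev zero    = Fin.fromℕ (2 + m′) , inj₂ (refl , cong suc (Fin.toℕ-fromℕ (2 + m′)))
  ∃prev (suc i) = Fin.inject₁ i , inj₁ (cong suc (sym (Fin.toℕ-inject₁ i)))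

  next-irrefl : {i : Fin N} → ¬ Next i i
  next-irrefl (inj₁ p) = <⇒≢ (n<1+n _) p
  next-irrefl {zero} (inj₂ (_ , ()))

  -- This is what makes the two neighbors on the cycle different; on two vertices successor and
  -- predecessor would coincide.
  next-asym : {i j : Fin N} → Next i j → ¬ Next j i
  next-asym (inj₁ p) (inj₁ q) = <-asym (≤-reflexive (sym p)) (≤-reflexive (sym q))
  next-asym {zero} {suc zero} (inj₁ _) (inj₂ (_ , ()))
  next-asym {zero} {suc (suc j)} (inj₁ ()) (inj₂ _)
  next-asym {suc zero} {zero} (inj₂ (_ , ())) (inj₁ _)
  next-asym {suc (suc i)} {zero} (inj₂ _) (inj₁ ())
  next-asym {zero} {zero} (inj₂ (_ , ())) (inj₂ _)

cycle-twoRegular : 3 ≤ m → TwoRegular (cycle m)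
cycle-twoRegular {suc (suc (suc m′))} _ v with a , v→a ← ∃next v | b , b→v ← ∃prev v =
  a , b , (λ { refl → next-asym v→a b→v }) ,
  ((λ { refl → next-irrefl v→a }) , inj₁ v→a) ,
  ((λ { refl → next-irrefl b→v }) , inj₂ b→v) ,
  λ { (_ , inj₁ v→w) → inj₁ (next-unique v→w v→a)
    ; (_ , inj₂ w→v) → inj₂ (prev-unique w→v b→v) }
cycle-twoRegular {1} (s≤s ())
cycle-twoRegular {2} (s≤s (s≤s ()))

cycles-twoRegular : ∀ {ns} → All (3 ≤_) ns → TwoRegular (disjointUnion cycle ns)
cycles-twoRegular {ns} ns≥3 (i , v)
  with a , b , a≢b , va , vb , only ← cycle-twoRegular (All.lookup ns≥3 (∈-lookup {xs = ns} i)) v =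
  (i , a) , (i , b) , (λ { refl → a≢b refl }) , within va , within vb ,
  λ { (within vw) → [ inj₁ ∘ cong (i ,_) , inj₂ ∘ cong (i ,_) ]′ (only vw) }

twoRegular⇒OtStar : (G : Graph (Fin n)) → TwoRegular G → OtStar n 3 G
twoRegular⇒OtStar G reg = let ns , ns≥3 , φ = twoRegular⇒cycles G reg in ns , ns≥3 , ≅-sym φ

OtStar⇒twoRegular : (G : Graph (Fin n)) → OtStar n 3 G → TwoRegular G
OtStar⇒twoRegular G (ns , ns≥3 , φ) = twoRegular-≅ φ (cycles-twoRegular ns≥3)

-- Maximum matchings

Isolated : Graph V → V → Set
Isolated G v = ∀ w → ¬ Adj G v w

-- Inside a complete graph a matching is maximum exactly when it misses at most one vertex. In this
-- form the notion is free of parity and passes to what remains after an edge is removed.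
record IsMaximumMatching (G : Graph V) : Set where
  field
    partner-unique  : ∀ {v a b} → Adj G v a → Adj G v b → a ≡ b
    isolated-unique : ∀ {u v} → Isolated G u → Isolated G v → u ≡ v

open IsMaximumMatching

matching-≅ : {G : Graph V} {H : Graph W} → G ≅ H → IsMaximumMatching H → IsMaximumMatching G
matching-≅ {G = G} {H} φ M = record
  { partner-unique  = λ va vb → to-injective bij
      (partner-unique M (Equivalence.to (adj _ _) va) (Equivalence.to (adj _ _) vb))
  ; isolated-unique = λ iu iv → to-injective bij (isolated-unique M (forth iu) (forth iv))
  }
  where
  open _≅_ φ
  open Inverse bij
  forth : ∀ {v} → Isolated G v → Isolated H (to v)
  forth {v} iso w a = iso (from w) (Equivalence.from (adj v (from w)) (subst (Adj H (to v)) (sym (strictlyInverseˡ w)) a))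

-- Treats both parities at once: the orders in the even and in the odd shape of the family are at
-- most 2, with at most one exception to being equal to 2.
record IsPairing (ns : List ℕ) : Set where
  field
    all≤2     : ∀ i → lookup ns i ≤ 2
    one-small : ∀ {i j} → lookup ns i < 2 → lookup ns j < 2 → i ≡ j

open IsPairing

pairing-∷ : ∀ {ns} → IsPairing ns → IsPairing (2 ∷ ns)
pairing-∷ P = record
  { all≤2     = λ { zero → ≤-refl ; (suc i) → all≤2 P i }
  ; one-small = λ { {zero}          2<2 _   → contradiction 2<2 (<-irrefl refl)
                  ; {suc _} {zero}  _   2<2 → contradiction 2<2 (<-irrefl refl)
                  ; {suc _} {suc _} p   q   → cong suc (one-small P p q) }
  }

pairing-replicate : ∀ k {ns} → IsPairing ns → IsPairing (replicate k 2 ++ ns)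
pairing-replicate zero    P = P
pairing-replicate (suc k) P = pairing-∷ (pairing-replicate k P)

pairing-[] : IsPairing []
pairing-[] = record { all≤2 = λ () ; one-small = λ { {()} } }

pairing-[1] : IsPairing [ 1 ]
pairing-[1] = record { all≤2 = λ { zero → s≤s z≤n } ; one-small = λ { {zero} {zero} _ _ → refl } }

Fin≤2-unique : m ≤ 2 → {v a b : Fin m} → v ≢ a → v ≢ b → a ≡ b
Fin≤2-unique m≤2 {zero}     {zero}     v≢a v≢b = contradiction refl v≢a
Fin≤2-unique m≤2 {zero}     {suc zero} {zero} v≢a v≢b = contradiction refl v≢b
Fin≤2-unique m≤2 {zero}     {suc zero} {suc zero} v≢a v≢b = refl
Fin≤2-unique m≤2 {suc zero} {zero}     {zero} v≢a v≢b = refl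
Fin≤2-unique m≤2 {suc zero} {zero}     {suc zero} v≢a v≢b = contradiction refl v≢b
Fin≤2-unique m≤2 {suc zero} {suc zero} v≢a v≢b = contradiction refl v≢a
Fin≤2-unique (s≤s (s≤s z≤n)) {suc (suc ())}
Fin≤2-unique (s≤s (s≤s z≤n)) {_} {suc (suc ())}
Fin≤2-unique (s≤s (s≤s z≤n)) {_} {_} {suc (suc ())}

complete-isolated⇒<2 : {v : Fin m} → Isolated (complete m) v → m < 2
complete-isolated⇒<2 {1}           _   = ≤-refl
complete-isolated⇒<2 {suc (suc m)} {zero}  iso = contradiction (λ ()) (iso (suc zero))
complete-isolated⇒<2 {suc (suc m)} {suc _} iso = contradiction (λ ()) (iso zero)

Fin<2-unique : m < 2 → (a b : Fin m) → a ≡ b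
Fin<2-unique _ zero zero = refl
Fin<2-unique (s≤s (s≤s z≤n)) (suc ()) _
Fin<2-unique (s≤s (s≤s z≤n)) zero (suc ())

pairing⇒matching : ∀ {ns} → IsPairing ns → IsMaximumMatching (disjointUnion complete ns)
pairing⇒matching {ns} P = record
  { partner-unique  = λ { {i , _} (within va) (within vb) → cong (i ,_) (Fin≤2-unique (all≤2 P i) va vb) }
  ; isolated-unique = unique
  }
  where
  small : ∀ {i v} → Isolated (disjointUnion complete ns) (i , v) → lookup ns i < 2
  small {i} iso = complete-isolated⇒<2 λ w → iso (i , w) ∘ within
  unique : ∀ {u v} → Isolated (disjointUnion complete ns) u → Isolated (disjointUnion complete ns) v → u ≡ v
  unique {i , u} {j , v} iu iv with refl ← one-small P (small iu) (small iv) = cong (i ,_) (Fin<2-unique (small iu) u v)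

module PeelEdge (G : Graph (Fin n)) (M : IsMaximumMatching G) {u v : Fin n} (uv : Adj G u v) where

  edge : Fin 2 → Fin n
  edge zero       = u
  edge (suc zero) = v

  edge-injective : Injective _≡_ _≡_ edge
  edge-injective {zero}     {zero}     _    = refl
  edge-injective {zero}     {suc zero} refl = contradiction uv (adj-irrefl G refl)
  edge-injective {suc zero} {zero}     refl = contradiction uv (adj-irrefl G refl)
  edge-injective {suc zero} {suc zero} _    = refl

  edge-closed : ∀ i {w} → Adj G (edge i) w → ∃[ j ] edge j ≡ w
  edge-closed zero       uw = suc zero , partner-unique M uv uw
  edge-closed (suc zero) vw = zero , partner-unique M (adj-sym G uv) vw

  edge-adj : ∀ i j → Adj (complete 2) i j ⇔ Adj G (edge i) (edge j)
  edge-adj zero       zero       = mk⇔ (contradiction refl) (λ a → contradiction a (adj-irrefl G refl))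
  edge-adj zero       (suc zero) = mk⇔ (λ _ → uv) (λ _ ())
  edge-adj (suc zero) zero       = mk⇔ (λ _ → adj-sym G uv) (λ _ ())
  edge-adj (suc zero) (suc zero) = mk⇔ (contradiction refl) (λ a → contradiction a (adj-irrefl G refl))

  open Peel G edge edge-injective edge-closed public

  rest-matching : IsMaximumMatching rest
  rest-matching = record
    { partner-unique  = λ va vb → injective (partner-unique M va vb)
    ; isolated-unique = λ iu iv → injective (isolated-unique M (lift iu) (lift iv))
    }
    where
    lift : ∀ {i} → Isolated rest i → Isolated G (at i)
    lift iso w a with j , refl ← neighbor-outside _ a = iso j a

-- Parity is carried as an equation that grows by 2 with each peeled edge; the quotient and
-- remainder in `OtStar` are computed from it only at the end.
IsPairs : Graph (Fin n) → ℕ → Set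
IsPairs {n} G k = (n ≡ k * 2     × disjointUnion complete (replicate k 2 ++ []) ≅ G)
                ⊎ (n ≡ 1 + k * 2 × disjointUnion complete (replicate k 2 ++ [ 1 ]) ≅ G)

matching⇒pairs : (G : Graph (Fin n)) → IsMaximumMatching G → ∃ (IsPairs G)
matching⇒pairs {n} = <-rec Pairs step n
  where
  Pairs : ℕ → Set₁
  Pairs n = (G : Graph (Fin n)) → IsMaximumMatching G → ∃ (IsPairs G)
  step : ∀ n → (∀ {m} → m < n → Pairs m) → Pairs n
  step n rec G M with Fin.any? (λ u → Fin.any? (adj? G u))
  step zero rec G M | no none = 0 , inj₁ (refl , nothing≅ complete G)
  step 1 rec G M | no none = 0 , inj₂ (refl , bijection⇒≅ (λ _ → zero)
    (λ { {zero , zero} {zero , zero} _ → refl }) (λ { zero → (zero , zero) , refl })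
    (λ { (zero , zero) (zero , zero) →
      mk⇔ (λ { (within a) → contradiction refl a }) (λ a → contradiction a (adj-irrefl G refl)) }))
  step (suc (suc n)) rec G M | no none =
    contradiction (isolated-unique M {zero} {suc zero} (λ w a → none (_ , w , a)) (λ w a → none (_ , w , a))) λ ()
  step n rec G M | yes (u , v , uv) = extend (rec smaller rest rest-matching)
    where
    open PeelEdge G M uv
    smaller : size < n
    smaller = subst (suc size ≤_) m+size≡n (n≤1+n _)
    extend : ∃ (IsPairs rest) → ∃ (IsPairs G)
    extend (k , inj₁ (eq , φ)) = suc k , inj₁ (trans (sym m+size≡n) (cong (2 +_) eq) , glue complete edge-adj φ)
    extend (k , inj₂ (eq , φ)) = suc k , inj₂ (trans (sym m+size≡n) (cong (2 +_) eq) , glue complete edge-adj φ)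

matching⇒OtStar : (G : Graph (Fin n)) → IsMaximumMatching G → OtStar n 2 G
matching⇒OtStar G M with matching⇒pairs G M
... | k , inj₁ (refl , φ) = inj₁ (m*n%n≡0 k 2 , subst (λ ns → G ≅ disjointUnion complete ns)
  (trans (++-identityʳ _) (cong (λ k → replicate k 2) (sym (m*n/n≡m k 2)))) (≅-sym φ))
... | k , inj₂ (refl , φ) = inj₂ ([m+kn]%n≡m%n 1 k 2 , subst (λ k → G ≅ disjointUnion complete (replicate k 2 ++ [ 1 ]))
  (sym (m*n/n≡m k 2)) (≅-sym φ))

OtStar⇒matching : (G : Graph (Fin n)) → OtStar n 2 G → IsMaximumMatching G
OtStar⇒matching {n} G (inj₁ (_ , φ)) = matching-≅ φ
  (pairing⇒matching (subst IsPairing (++-identityʳ _) (pairing-replicate (n / 2) pairing-[])))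
OtStar⇒matching {n} G (inj₂ (_ , φ)) = matching-≅ φ (pairing⇒matching (pairing-replicate ((n ∸ 1) / 2) pairing-[1]))

n≤m*2+1⇒n/2≤m : ∀ {n m} → n ≤ 1 + m * 2 → n / 2 ≤ m
n≤m*2+1⇒n/2≤m {n} {m} n≤ = ≤-trans (/-monoˡ-≤ 2 n≤)
  (≤-reflexive (trans (+-distrib-/-∣ʳ 1 {m * 2} (divides m refl)) (m*n/n≡m m 2)))

m*2≤n⇒m≤n/2 : ∀ {n m} → m * 2 ≤ n → m ≤ n / 2
m*2≤n⇒m≤n/2 {n} {m} ≤n = subst (_≤ n / 2) (m*n/n≡m m 2) (/-monoˡ-≤ 2 ≤n)

matching⇒deg≤1 : (G : Graph (Fin n)) → IsMaximumMatching G → ∀ v → deg G v ≤ 1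
matching⇒deg≤1 G M v = count≤1 (adj? G v) (partner-unique M)

-- All degrees are at most 1, and at most one of them is 0, so `2 e(G)` is at most `n` and at least
-- `n - 1`.
matching⇒e≡n/2 : (G : Graph (Fin n)) → IsMaximumMatching G → e G ≡ n / 2
matching⇒e≡n/2 {n} G M = ≤-antisym
  (m*2≤n⇒m≤n/2 (begin
    e G * 2              ≡⟨ 2e≡ ⟩
    sum (deg G)          ≤⟨ sum-mono (matching⇒deg≤1 G M) ⟩
    sum {n} (λ _ → 1)    ≡⟨ trans (sum-const n 1) (*-identityʳ n) ⟩
    n                    ∎))
  (n≤m*2+1⇒n/2≤m (begin
    n                                        ≡⟨ trans (sum-const n 1) (*-identityʳ n) ⟨
    sum {n} (λ _ → 1)                        ≤⟨ sum-mono covered ⟩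
    sum {n} (λ v → 𝟙 (isolated? v) + deg G v) ≡⟨ ∑-distrib-+ {n} (λ v → 𝟙 (isolated? v)) (deg G) ⟩
    count isolated? + sum (deg G)            ≤⟨ +-mono-≤ (count≤1 isolated? λ p q → isolated-unique M (λ w a → p (w , a)) (λ w a → q (w , a))) (≤-reflexive (sym 2e≡)) ⟩
    1 + e G * 2                              ∎))
  where
  open ≤-Reasoning
  2e≡ : e G * 2 ≡ sum (deg G)
  2e≡ = trans (*-comm (e G) 2) (handshake G)
  isolated? : Decidable (λ v → ¬ (∃[ w ] Adj G v w))
  isolated? v = ¬? (Fin.any? (adj? G v))
  covered : ∀ v → 1 ≤ 𝟙 (isolated? v) + deg G v
  covered v with Fin.any? (adj? G v)
  ... | no _ = s≤s z≤n
  ... | yes (w , a) = injection⇒≤count (adj? G v) {λ (_ : Fin 1) → w} (λ { {zero} {zero} _ → refl }) (λ _ → a)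

-- Two isolated vertices would lower the degree sum to at most `n - 2`, leaving fewer than `n / 2`
-- edges.
deg≤1⇒matching : (G : Graph (Fin n)) → (∀ v → deg G v ≤ 1) → n / 2 ≤ e G → IsMaximumMatching G
deg≤1⇒matching {n} G deg≤1 n/2≤e = record { partner-unique = unique ; isolated-unique = isolated }
  where
  unique : ∀ {v a b} → Adj G v a → Adj G v b → a ≡ b
  unique {v} {a} {b} va vb with a ≟ b
  ... | yes a≡b = a≡b
  ... | no a≢b = contradiction (≤-trans (two-neighbors⇒2≤deg G a≢b va vb) (deg≤1 v)) 1+n≰n
  isolated : ∀ {u v} → Isolated G u → Isolated G v → u ≡ v
  isolated {u} {v} iu iv with u ≟ v
  ... | yes u≡v = u≡v
  ... | no u≢v = contradiction (≤-trans (m*2≤n⇒m≤n/2 bound) n/2≤e) 1+n≰n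
    where
    open ≤-Reasoning
    slack : ∀ w → 𝟙 (u ≟ w) + (𝟙 (v ≟ w) + deg G w) ≤ 1
    slack w with u ≟ w | v ≟ w
    ... | yes refl | yes refl = contradiction refl u≢v
    ... | yes refl | no _     = ≤-reflexive (cong suc (count-∄ (adj? G w) iu))
    ... | no _     | yes refl = ≤-reflexive (cong suc (count-∄ (adj? G w) iv))
    ... | no _     | no _     = deg≤1 w
    bound : suc (e G) * 2 ≤ n
    bound = begin
      2 + e G * 2                                ≡⟨ cong (2 +_) (trans (*-comm (e G) 2) (handshake G)) ⟩
      1 + (1 + sum (deg G))                      ≡⟨ cong₂ (λ a b → a + (b + sum (deg G))) (count-≟ u) (count-≟ v) ⟨
      count (u ≟_) + (count (v ≟_) + sum (deg G)) ≡⟨ cong (count (u ≟_) +_) (∑-distrib-+ {n} (λ w → 𝟙 (v ≟ w)) (deg G)) ⟨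
      count (u ≟_) + sum {n} (λ w → 𝟙 (v ≟ w) + deg G w) ≡⟨ ∑-distrib-+ {n} (λ w → 𝟙 (u ≟ w)) _ ⟨
      sum {n} (λ w → 𝟙 (u ≟ w) + (𝟙 (v ≟ w) + deg G w)) ≤⟨ sum-mono slack ⟩
      sum {n} (λ _ → 1)                          ≡⟨ trans (sum-const n 1) (*-identityʳ n) ⟩
      n                                          ∎

-- The involution exchanging `2 i` and `2 i + 1`. For odd `n` the partner of the last vertex falls
-- outside `Fin n`, which leaves that vertex isolated.
partner : ℕ → ℕ
partner 0             = 1
partner 1             = 0
partner (suc (suc i)) = 2 + partner i

partner-involutive : ∀ i → partner (partner i) ≡ i
partner-involutive 0             = refl
partner-involutive 1             = refl
partner-involutive (suc (suc i)) = cong (2 +_) (partner-involutive i)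

partner-≢ : ∀ i → partner i ≢ i
partner-≢ (suc (suc i)) eq = partner-≢ i (suc-injective (suc-injective eq))

partner≤1+ : ∀ i → partner i ≤ suc i
partner≤1+ 0             = ≤-refl
partner≤1+ 1             = z≤n
partner≤1+ (suc (suc i)) = s≤s (s≤s (partner≤1+ i))

partnerGraph : (n : ℕ) → Graph (Fin n)
partnerGraph n = record
  { Adj        = λ u v → partner (toℕ u) ≡ toℕ v
  ; adj?       = λ u v → partner (toℕ u) ℕ.≟ toℕ v
  ; adj-sym    = λ {u} eq → trans (cong partner (sym eq)) (partner-involutive (toℕ u))
  ; adj-irrefl = λ { {u} refl → partner-≢ (toℕ u) }
  }

partnerGraph-matching : ∀ n → IsMaximumMatching (partnerGraph n)
partnerGraph-matching n = record
  { partner-unique  = λ va vb → Fin.toℕ-injective (trans (sym va) vb)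
  ; isolated-unique = λ iu iv → Fin.toℕ-injective (suc-injective (trans (last iu) (sym (last iv))))
  }
  where
  last : ∀ {v} → Isolated (partnerGraph n) v → suc (toℕ v) ≡ n
  last {v} iso with partner (toℕ v) <? n
  ... | yes p<n = contradiction (sym (Fin.toℕ-fromℕ< p<n)) (iso (fromℕ< p<n))
  ... | no p≮n  = ≤-antisym (Fin.toℕ<n v) (≤-trans (≮⇒≥ p≮n) (partner≤1+ (toℕ v)))

-- Complete split graphs

private variable
  p q : ℕ

subset-of-size : p ≤ n → ∃[ X ] ∣_∣ {n} X ≡ p
subset-of-size {n = n} z≤n = Subset.⊥ , ∣⊥∣≡0 n
subset-of-size (s≤s p≤n) with X , eq ← subset-of-size p≤n = inside Vec.∷ X , cong suc eq

∣∣≡count : (X : Subset n) → ∣ X ∣ ≡ count (_∈? X)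
∣∣≡count Vec.[]             = refl
∣∣≡count (inside  Vec.∷ X) = cong suc (∣∣≡count X)
∣∣≡count (outside Vec.∷ X) = ∣∣≡count X

splitGraph : Subset n → Graph (Fin n)
splitGraph X = record
  { Adj        = λ u v → u ≢ v × (u ∈ X ⊎ v ∈ X)
  ; adj?       = λ u v → ¬? (u ≟ v) ×-dec ((u ∈? X) ⊎-dec (v ∈? X))
  ; adj-sym    = λ (u≢v , m) → u≢v ∘ sym , swap m
  ; adj-irrefl = λ u≡v (u≢v , _) → u≢v u≡v
  }

splitGraph-isCompleteSplit : (X : Subset n) → ∣ X ∣ ≡ p → n ∸ p ≡ q → IsCompleteSplit p q (splitGraph X)
splitGraph-isCompleteSplit X refl refl =
  X , refl , ∣∁p∣≡n∸∣p∣ X , (λ u∈ _ u≢v → u≢v , inj₁ u∈) ,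
  (λ { u∉ v∉ (_ , m) → [ u∉ , v∉ ]′ m }) ,
  λ u∈ v∉ → (λ { refl → v∉ u∈ }) , inj₁ u∈

deg-dominating : (G : Graph (Fin n)) (v : Fin n) → (∀ {w} → v ≢ w → Adj G v w) → suc (deg G v) ≡ n
deg-dominating {n} G v dom = begin
  1 + deg G v                                     ≡⟨ cong (_+ deg G v) (count-≟ v) ⟨
  count (v ≟_) + deg G v                          ≡⟨ ∑-distrib-+ {n} (λ w → 𝟙 (v ≟ w)) _ ⟨
  sum {n} (λ w → 𝟙 (v ≟ w) + 𝟙 (adj? G v w))      ≡⟨ sum-cong-≗ {n} one ⟩
  sum {n} (λ _ → 1)                               ≡⟨ trans (sum-const n 1) (*-identityʳ n) ⟩
  n                                               ∎
  where
  open ≡-Reasoning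
  one : ∀ w → 𝟙 (v ≟ w) + 𝟙 (adj? G v w) ≡ 1
  one w with v ≟ w
  ... | yes refl = cong suc (𝟙-no (adj-irrefl G refl) (adj? G v v))
  ... | no v≢w   = 𝟙-yes (dom v≢w) (adj? G v w)

module _ (G : Graph (Fin n)) (split : IsCompleteSplit p q G) where
  private
    X           = proj₁ split
    ∣X∣≡p       = proj₁ (proj₂ split)
    clique      = proj₁ (proj₂ (proj₂ (proj₂ split)))
    independent = proj₁ (proj₂ (proj₂ (proj₂ (proj₂ split))))
    join        = proj₂ (proj₂ (proj₂ (proj₂ (proj₂ split))))

    dominating : ∀ {u w} → u ∈ X → u ≢ w → Adj G u w
    dominating {w = w} u∈ u≢w with w ∈? X
    ... | yes w∈ = clique u∈ w∈ u≢w
    ... | no w∉  = join u∈ w∉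

    deg-outside : ∀ {u} → u ∉ X → deg G u ≡ p
    deg-outside {u} u∉ = trans
      (count-cong (adj? G u) (_∈? X) λ w → mk⇔ (neighbor w) (λ w∈ → adj-sym G (join w∈ u∉)))
      (trans (sym (∣∣≡count X)) ∣X∣≡p)
      where
      neighbor : ∀ w → Adj G u w → w ∈ X
      neighbor w a with w ∈? X
      ... | yes w∈ = w∈
      ... | no w∉  = contradiction a (independent u∉ w∉)

  split-degrees : ∀ v → suc (deg G v) ≡ n ⊎ deg G v ≡ p
  split-degrees v with v ∈? X
  ... | yes v∈ = inj₁ (deg-dominating G v (dominating v∈))
  ... | no v∉  = inj₂ (deg-outside v∉)

  -- There are `p` vertices of degree `M` and `n - p` of degree `p`; adding `p * p` removes the
  -- subtraction.
  split-edges : ∀ {M} → n ≡ suc M → 2 * e G + p * p ≡ 2 * (p * M) + p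
  split-edges {M} refl = begin
    2 * e G + p * p                   ≡⟨ cong (_+ p * p) (handshake G) ⟩
    sum (deg G) + p * p               ≡⟨ cong (_+ p * p) (sum-cong-≗ degree) ⟩
    sum {n} (λ v → 𝟙 (v ∈? X) * M + 𝟙 (¬? (v ∈? X)) * p) + p * p
      ≡⟨ cong (_+ p * p) (∑-distrib-+ {n} (λ v → 𝟙 (v ∈? X) * M) (λ v → 𝟙 (¬? (v ∈? X)) * p)) ⟩
    sum {n} (λ v → 𝟙 (v ∈? X) * M) + sum {n} (λ v → 𝟙 (¬? (v ∈? X)) * p) + p * p
      ≡⟨ cong (_+ p * p) (cong₂ _+_ (*-distribʳ-sum {n} M (λ v → 𝟙 (v ∈? X))) (*-distribʳ-sum {n} p (λ v → 𝟙 (¬? (v ∈? X))))) ⟨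
    count (_∈? X) * M + y * p + p * p ≡⟨ cong (λ x → x * M + y * p + p * p) (trans (sym (∣∣≡count X)) ∣X∣≡p) ⟩
    p * M + y * p + p * p             ≡⟨ collect p M y ⟩
    p * M + p * (p + y)               ≡⟨ cong (λ x → p * M + p * x) p+y≡n ⟩
    p * M + p * suc M                 ≡⟨ double p M ⟩
    2 * (p * M) + p                   ∎
    where
    open ≡-Reasoning
    y = count (λ v → ¬? (v ∈? X))
    p+y≡n : p + y ≡ n
    p+y≡n = trans (cong (_+ y) (trans (sym ∣X∣≡p) (∣∣≡count X))) (count-complement (_∈? X))
    collect : ∀ p M y → p * M + y * p + p * p ≡ p * M + p * (p + y)
    collect = solve-∀
    double : ∀ p M → p * M + p * suc M ≡ 2 * (p * M) + p
    double = solve-∀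
    degree : ∀ v → deg G v ≡ 𝟙 (v ∈? X) * M + 𝟙 (¬? (v ∈? X)) * p
    degree v with v ∈? X
    ... | yes v∈ = trans (suc-injective (deg-dominating G v (dominating v∈)))
                         (sym (trans (+-identityʳ (1 * M)) (*-identityˡ M)))
    ... | no v∉  = trans (deg-outside v∉) (sym (+-identityʳ p))

-- Makes the division in `otStar` exact: its numerator is `K * suc K` with `K = k - 2`.
pronic-even : ∀ K → ∃[ t ] K * suc K ≡ t * 2
pronic-even zero    = 0 , refl
pronic-even (suc K) with t , eq ← pronic-even K =
  t + suc K , trans (expand K) (trans (cong (_+ suc K * 2) eq) (sym (*-distribʳ-+ 2 t (suc K))))
  where
  expand : ∀ K → suc K * suc (suc K) ≡ K * suc K + suc K * 2
  expand = solve-∀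

-- That is, 2 otStar n k = 2 K n - K (K + 1) with K = k - 2 and n = M + 1, with all subtractions cleared.
otStar-doubled : ∀ M j → 4 + j ≤ suc M →
  2 * otStar (suc M) (4 + j) + (2 + j) * (2 + j) ≡ 2 * ((2 + j) * M) + (2 + j)
otStar-doubled M j k≤n with t , eq ← pronic-even (2 + j) = +-cancelʳ-≡ (2 + j) _ _ (begin
  2 * s + K * K + K                 ≡⟨ collect s K ⟩
  2 * s + K * suc K                 ≡⟨ cong (2 * s +_) eq ⟩
  2 * s + t * 2                     ≡⟨ collect₂ s t ⟩
  2 * (s + t)                       ≡⟨ cong (λ s → 2 * (s + t)) s≡ ⟩
  2 * (K * suc M ∸ t + t)           ≡⟨ cong (2 *_) (m∸n+n≡m t≤) ⟩
  2 * (K * suc M)                   ≡⟨ expand K M ⟩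
  2 * (K * M) + K + K               ∎)
  where
  open ≡-Reasoning
  K = 2 + j
  s = otStar (suc M) (4 + j)
  collect : ∀ s K → 2 * s + K * K + K ≡ 2 * s + K * suc K
  collect = solve-∀
  collect₂ : ∀ s t → 2 * s + t * 2 ≡ 2 * (s + t)
  collect₂ = solve-∀
  expand : ∀ K M → 2 * (K * suc M) ≡ 2 * (K * M) + K + K
  expand = solve-∀
  square : ∀ j → (4 + j) * (4 + j) ≡ 3 * (4 + j) + (4 + 5 * j + j * j)
  square = solve-∀
  pronic : ∀ j → 4 + 5 * j + j * j + 2 ≡ (2 + j) * suc (2 + j)
  pronic = solve-∀
  s≡ : s ≡ K * suc M ∸ t
  s≡ = cong (K * suc M ∸_) (begin
    ((4 + j) * (4 + j) ∸ 3 * (4 + j) + 2) / 2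
      ≡⟨ cong (λ a → (a ∸ 3 * (4 + j) + 2) / 2) (square j) ⟩
    (3 * (4 + j) + (4 + 5 * j + j * j) ∸ 3 * (4 + j) + 2) / 2
      ≡⟨ cong (λ a → (a + 2) / 2) (m+n∸m≡n (3 * (4 + j)) _) ⟩
    (4 + 5 * j + j * j + 2) / 2
      ≡⟨ cong (_/ 2) (trans (pronic j) eq) ⟩
    (t * 2) / 2
      ≡⟨ m*n/n≡m t 2 ⟩
    t ∎)
  t≤ : t ≤ K * suc M
  t≤ = ≤-trans (m≤m*n t 2) (≤-trans (≤-reflexive (sym eq)) (*-monoʳ-≤ K (≤-trans (n≤1+n _) k≤n)))

split-size : ∀ n j → 4 + j ≤ n → n ∸ (4 + j) + 2 ≡ n ∸ (2 + j)
split-size n j k≤n = begin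
  n ∸ (4 + j) + 2        ≡⟨ cong (λ a → n ∸ a + 2) (+-comm 2 (2 + j)) ⟩
  n ∸ (2 + j + 2) + 2    ≡⟨ cong (_+ 2) (∸-+-assoc n (2 + j) 2) ⟨
  n ∸ (2 + j) ∸ 2 + 2    ≡⟨ m∸n+n≡m (subst (_≤ n ∸ (2 + j)) (m+n∸n≡m 2 (2 + j)) (∸-monoˡ-≤ (2 + j) k≤n)) ⟩
  n ∸ (2 + j)            ∎
  where open ≡-Reasoning

-- Colorings without an (r , b)-colored star

-- Equality case of counting `v` together with its neighbors: each vertex contributes at most 1, and
-- the total `n` leaves no vertex out.
fullyAdjacent : (G : Graph (Fin n)) {v : Fin n} → n ≤ suc (deg G v) → ∀ {w} → v ≢ w → Adj G v w
fullyAdjacent {n} G {v} n≤ {w} v≢w = 𝟙≡1⇒ (adj? G v w) (trans (sym (cong (_+ 𝟙 (adj? G v w)) (𝟙-no v≢w (v ≟ w)))) (tight w))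
  where
  one : ∀ w → 𝟙 (v ≟ w) + 𝟙 (adj? G v w) ≤ 1
  one w with v ≟ w
  ... | yes refl = ≤-reflexive (cong suc (𝟙-no (adj-irrefl G refl) (adj? G v v)))
  ... | no _     = 𝟙≤1 (adj? G v w)
  tight : ∀ w → 𝟙 (v ≟ w) + 𝟙 (adj? G v w) ≡ 1
  tight = sum-mono-tight one (begin
    sum {n} (λ _ → 1)                           ≡⟨ trans (sum-const n 1) (*-identityʳ n) ⟩
    n                                           ≤⟨ n≤ ⟩
    1 + deg G v                                 ≡⟨ cong (_+ deg G v) (count-≟ v) ⟨
    count (v ≟_) + deg G v                      ≡⟨ ∑-distrib-+ {n} (λ w → 𝟙 (v ≟ w)) _ ⟨
    sum {n} (λ w → 𝟙 (v ≟ w) + 𝟙 (adj? G v w))  ∎)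
    where open ≤-Reasoning

swapColors : Coloring n → Coloring n
swapColors c = record
  { R = B c ; B = R c ; covers = swap ∘ covers c ; disjoint = λ b r → disjoint c r b }

-- r and b here are one less than the numbers of red and blue edges of the missing star.
module Mixed {M} (c : Coloring (suc M)) (r b : ℕ) (avoids : Avoids c (suc r) (suc b)) where
  private
    N = suc M
    K = r + b

  -- Abstract, since otherwise does (low? v) unfolds and can no longer be matched on.
  abstract
    low? : Decidable (λ v → deg (R c) v < suc r)
    low? v = deg (R c) v <? suc r

  -- A vertex that satisfies both degree bounds counts as low, so that low and high partition the
  -- vertices; `avoids` bounds the blue degree of every high vertex by `b`.
  high? : Decidable (λ v → ¬ (deg (R c) v < suc r))
  high? v = ¬? (low? v)

  α γ : Fin N → ℕ
  α v = 𝟙 (low? v)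
  γ v = 𝟙 (high? v)

  x y : ℕ
  x = count low?
  y = count high?

  x+y≡N : x + y ≡ N
  x+y≡N = count-complement low?

  -- Every low–high pair is either a red edge at its low end or a blue edge at its high end.
  cross : x * y ≤ x * r + y * b
  cross = begin
    x * y                                                   ≡⟨ *-distribʳ-sum {N} y α ⟩
    sum {N} (λ u → α u * y)                                 ≡⟨ sum-cong-≗ {N} (λ u → *-distribˡ-sum {N} (α u) γ) ⟩
    sum {N} (λ u → sum {N} (λ v → α u * γ v))               ≤⟨ sum-mono {N} (λ u → sum-mono {N} (pair u)) ⟩
    sum {N} (λ u → sum {N} (λ v → α u * red u v + γ v * blue v u))
      ≡⟨ sum-cong-≗ {N} (λ u → ∑-distrib-+ {N} (λ v → α u * red u v) (λ v → γ v * blue v u)) ⟩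
    sum {N} (λ u → sum {N} (λ v → α u * red u v) + sum {N} (λ v → γ v * blue v u))
      ≡⟨ ∑-distrib-+ {N} (λ u → sum {N} (λ v → α u * red u v)) (λ u → sum {N} (λ v → γ v * blue v u)) ⟩
    sum {N} (λ u → sum {N} (λ v → α u * red u v)) + sum {N} (λ u → sum {N} (λ v → γ v * blue v u))
      ≡⟨ cong (sum {N} (λ u → sum {N} (λ v → α u * red u v)) +_) (∑-comm {N} {N} (λ u v → γ v * blue v u)) ⟩
    sum {N} (λ u → sum {N} (λ v → α u * red u v)) + sum {N} (λ v → sum {N} (λ u → γ v * blue v u))
      ≡⟨ cong₂ _+_ (sum-cong-≗ {N} (λ u → *-distribˡ-sum {N} (α u) (red u)))
                   (sum-cong-≗ {N} (λ v → *-distribˡ-sum {N} (γ v) (blue v))) ⟨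
    sum {N} (λ u → α u * deg (R c) u) + sum {N} (λ v → γ v * deg (B c) v)
      ≤⟨ +-mono-≤ (sum-mono {N} low≤) (sum-mono {N} high≤) ⟩
    sum {N} (λ u → α u * r) + sum {N} (λ v → γ v * b)
      ≡⟨ cong₂ _+_ (*-distribʳ-sum {N} r α) (*-distribʳ-sum {N} b γ) ⟨
    x * r + y * b                                           ∎
    where
    open ≤-Reasoning
    red blue : Fin N → Fin N → ℕ
    red u v  = 𝟙 (adj? (R c) u v)
    blue u v = 𝟙 (adj? (B c) u v)
    low≤ : ∀ u → α u * deg (R c) u ≤ α u * r
    low≤ u with low? u
    ... | yes (s≤s d≤r) = *-monoʳ-≤ 1 d≤r
    ... | no _          = z≤n
    high≤ : ∀ v → γ v * deg (B c) v ≤ γ v * b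
    high≤ v with low? v
    ... | yes _ = z≤n
    ... | no hi with avoids v
    ...   | inj₁ lo        = contradiction lo hi
    ...   | inj₂ (s≤s d≤b) = *-monoʳ-≤ 1 d≤b
    pair : ∀ u v → α u * γ v ≤ α u * red u v + γ v * blue v u
    pair u v with low? u | low? v
    ... | no _   | _      = z≤n
    ... | yes _  | yes _  = z≤n
    ... | yes lo | no hi with covers c {u} {v} (λ { refl → hi lo })
    ...   | inj₁ a = ≤-trans (≤-reflexive (sym (𝟙-yes a (adj? (R c) u v)))) (≤-trans (m≤n*m _ 1) (m≤m+n (1 * red u v) (1 * blue v u)))
    ...   | inj₂ a = ≤-trans (≤-reflexive (sym (𝟙-yes (adj-sym (B c) a) (adj? (B c) v u)))) (≤-trans (m≤n*m _ 1) (m≤n+m (1 * blue v u) (1 * red u v)))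

  deg≤M : ∀ v → deg (R c) v ≤ M
  deg≤M v = ≤-trans (m≤m+n _ (deg (B c) v)) (≤-reflexive (suc-injective (deg-red+blue c v)))

  deg≤ : ∀ v → deg (R c) v ≤ α v * r + γ v * M
  deg≤ v with low? v
  ... | yes (s≤s d≤r) = ≤-trans d≤r (≤-trans (m≤n*m r 1) (m≤m+n (1 * r) 0))
  ... | no _          = ≤-trans (deg≤M v) (m≤n*m M 1)

  sum-bound : sum {N} (λ v → α v * r + γ v * M) ≡ x * r + y * M
  sum-bound = trans (∑-distrib-+ {N} (λ v → α v * r) (λ v → γ v * M))
    (sym (cong₂ _+_ (*-distribʳ-sum {N} r α) (*-distribʳ-sum {N} M γ)))

  edges≤ : 2 * e (R c) ≤ x * r + y * M
  edges≤ = begin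
    2 * e (R c)                          ≡⟨ handshake (R c) ⟩
    sum (deg (R c))                      ≤⟨ sum-mono {N} deg≤ ⟩
    sum {N} (λ v → α v * r + γ v * M)    ≡⟨ sum-bound ⟩
    x * r + y * M                        ∎
    where open ≤-Reasoning

  module _ (y≤x : y ≤ x) where

    -- With `y ≤ x`, the term `y * b` in `cross` is at most `x * b`, and then `x` cancels; if `x` is
    -- 0, so is `y`.
    y≤K : y ≤ K
    y≤K with x in x≡
    ... | zero  = ≤-trans y≤x z≤n
    ... | suc x′ = *-cancelˡ-≤ (suc x′) (begin
      suc x′ * y              ≡⟨ cong (_* y) x≡ ⟨
      x * y                   ≤⟨ cross ⟩
      x * r + y * b           ≤⟨ +-monoʳ-≤ (x * r) (*-monoˡ-≤ b (subst (y ≤_) (sym x≡) y≤x)) ⟩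
      x * r + x * b           ≡⟨ *-distribˡ-+ x r b ⟨
      x * K                   ≡⟨ cong (_* K) x≡ ⟩
      suc x′ * K              ∎)
      where open ≤-Reasoning

    -- `D` is `n - k`, since `n = M + 1` and `k = K + 2`. Together with `z = K - y` it makes every
    -- quantity a polynomial without subtraction.
    module _ {D} (M≡ : M ≡ suc D + K) where
      z : ℕ
      z = K ∸ y

      z+y≡K : z + y ≡ K
      z+y≡K = m∸n+n≡m y≤K

      -- The deficit of `x * r + y * M` from its maximum, after substituting `r = K - b`,
      -- `y = K - z` and `x = D + 2 + z`. The coefficients of `b` and `z` are positive, so it
      -- vanishes only for `b = z = 0`.
      slack : ℕ
      slack = suc (suc D) * b + z * (suc D + b)

      bound-slack : x * r + y * M + K * K + slack ≡ 2 * (K * M) + K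
      bound-slack = begin
        x * r + y * M + K * K + slack       ≡⟨ cong (λ x → x * r + y * M + K * K + slack) x≡ ⟩
        (suc (suc D) + z) * r + y * M + K * K + slack
          ≡⟨ cong (λ M → (suc (suc D) + z) * r + y * M + K * K + slack) M≡ ⟩
        (suc (suc D) + z) * r + y * (suc D + K) + K * K + slack
          ≡⟨ regroup D z r b y K ⟩
        suc (suc D) * K + z * K + (z + y) * suc D + y * K + K * K
          ≡⟨ cong (λ a → suc (suc D) * K + z * K + a * suc D + y * K + K * K) z+y≡K ⟩
        suc (suc D) * K + z * K + K * suc D + y * K + K * K
          ≡⟨ regroup₂ D z y K ⟩
        suc (suc D) * K + (z + y) * K + K * suc D + K * K
          ≡⟨ cong (λ a → suc (suc D) * K + a * K + K * suc D + K * K) z+y≡K ⟩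
        suc (suc D) * K + K * K + K * suc D + K * K
          ≡⟨ finish D K ⟩
        2 * (K * (suc D + K)) + K
          ≡⟨ cong (λ M → 2 * (K * M) + K) M≡ ⟨
        2 * (K * M) + K ∎
        where
        open ≡-Reasoning
        x≡ : x ≡ suc (suc D) + z
        x≡ = +-cancelʳ-≡ y x (suc (suc D) + z) (begin
          x + y                    ≡⟨ x+y≡N ⟩
          suc M                    ≡⟨ cong suc M≡ ⟩
          suc (suc D) + K          ≡⟨ cong (suc (suc D) +_) z+y≡K ⟨
          suc (suc D) + (z + y)    ≡⟨ +-assoc (suc (suc D)) z y ⟨
          suc (suc D) + z + y      ∎)
        regroup : ∀ D z r b y L → (suc (suc D) + z) * r + y * (suc D + L) + L * L + (suc (suc D) * b + z * (suc D + b))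
          ≡ suc (suc D) * (r + b) + z * (r + b) + (z + y) * suc D + y * L + L * L
        regroup = solve-∀
        regroup₂ : ∀ D z y K → suc (suc D) * K + z * K + K * suc D + y * K + K * K ≡ suc (suc D) * K + (z + y) * K + K * suc D + K * K
        regroup₂ = solve-∀
        finish : ∀ D K → suc (suc D) * K + K * K + K * suc D + K * K ≡ 2 * (K * (suc D + K)) + K
        finish = solve-∀

      edges+slack≤ : 2 * e (R c) + K * K + slack ≤ 2 * (K * M) + K
      edges+slack≤ = ≤-trans (+-monoˡ-≤ slack (+-monoˡ-≤ (K * K) edges≤)) (≤-reflexive bound-slack)

      -- By `otStar-doubled`, for `K ≥ 2` this hypothesis says that `R c` has at least
      -- `otStar N (2 + K)` edges.
      module _ (many : 2 * (K * M) + K ≤ 2 * e (R c) + K * K) where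

        slack≡0 : slack ≡ 0
        slack≡0 = n≤0⇒n≡0 (+-cancelˡ-≤ (2 * e (R c) + K * K) slack 0
          (≤-trans edges+slack≤ (≤-trans many (≤-reflexive (sym (+-identityʳ _))))))

        b≡0 : b ≡ 0
        b≡0 = [ (λ ()) , id ]′ (m*n≡0⇒m≡0∨n≡0 (suc (suc D)) (m+n≡0⇒m≡0 (suc (suc D) * b) slack≡0))

        y≡K : y ≡ K
        y≡K = trans (cong (_+ y) (sym z≡0)) z+y≡K
          where
          z≡0 : z ≡ 0
          z≡0 = [ id , (λ ()) ]′ (m*n≡0⇒m≡0∨n≡0 z (m+n≡0⇒n≡0 (suc (suc D) * b) slack≡0))

        r≡K : r ≡ K
        r≡K = trans (sym (+-identityʳ r)) (cong (r +_) (sym b≡0))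

        -- Here `slack` is 0, so the upper bound on the degree sum is attained and each degree is as
        -- large as `deg≤` allows.
        degree : ∀ v → deg (R c) v ≡ α v * r + γ v * M
        degree = sum-mono-tight deg≤ (begin
          sum {N} (λ v → α v * r + γ v * M)    ≡⟨ sum-bound ⟩
          x * r + y * M                        ≤⟨ +-cancelʳ-≤ (K * K) _ _ (+-cancelʳ-≤ slack _ _ (≤-trans (≤-reflexive bound-slack) (≤-trans many (m≤m+n _ slack)))) ⟩
          2 * e (R c)                          ≡⟨ handshake (R c) ⟩
          sum (deg (R c))                      ∎)
          where open ≤-Reasoning

        low-degree : ∀ {v} → deg (R c) v < suc r → deg (R c) v ≡ y
        low-degree {v} lo = trans (degree v) (trans
          (cong₂ (λ a g → a * r + g * M) (𝟙-yes lo (low? v)) (𝟙-no (contradiction lo) (high? v)))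
          (trans (+-identityʳ (1 * r)) (trans (+-identityʳ r) (trans r≡K (sym y≡K)))))

        high-degree : ∀ {v} → ¬ (deg (R c) v < suc r) → deg (R c) v ≡ M
        high-degree {v} hi = trans (degree v) (trans
          (cong₂ (λ a g → a * r + g * M) (𝟙-no hi (low? v)) (𝟙-yes hi (high? v)))
          (+-identityʳ M))

        high-adj : ∀ {u v} → ¬ (deg (R c) u < suc r) → u ≢ v → Adj (R c) u v
        high-adj hi = fullyAdjacent (R c) (≤-reflexive (cong suc (sym (high-degree hi))))

        -- A low vertex is adjacent to all `y` high vertices and has degree `y`, which leaves no
        -- room for a low neighbor.
        low-independent : ∀ {u v} → deg (R c) u < suc r → deg (R c) v < suc r → ¬ Adj (R c) u v
        low-independent {u} {v} lo lo′ a = contradiction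
            (trans (sym (𝟙-no (contradiction lo′) (high? v))) (trans (tight v) (𝟙-yes a (adj? (R c) u v))))
            λ ()
          where
          tight : ∀ w → γ w ≡ 𝟙 (adj? (R c) u w)
          tight = sum-mono-tight
            (λ w → 𝟙-mono (λ hi → adj-sym (R c) (high-adj hi λ { refl → hi lo })) (high? w) (adj? (R c) u w))
            (≤-reflexive (low-degree lo))

        isCompleteSplit : IsCompleteSplit K (N ∸ K) (R c)
        isCompleteSplit = X , ∣X∣≡K , trans (∣∁p∣≡n∸∣p∣ X) (cong (N ∸_) ∣X∣≡K)
          , (λ u∈ _ → high-adj (∈⇒high u∈))
          , (λ u∉ v∉ → low-independent (∉⇒low u∉) (∉⇒low v∉))
          , λ { {u} u∈ v∉ → high-adj (∈⇒high u∈) λ { refl → v∉ u∈ } }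
          where
          X : Subset N
          X = Vec.tabulate (λ v → does (high? v))
          ∈⇒high : ∀ {v} → v ∈ X → ¬ (deg (R c) v < suc r)
          ∈⇒high {v} v∈ with low? v | trans (sym (Vec.lookup∘tabulate (λ v → does (high? v)) v)) (Vec.[]=⇒lookup v∈)
          ... | no hi | _ = hi
          ... | yes _ | ()
          high⇒∈ : ∀ {v} → ¬ (deg (R c) v < suc r) → v ∈ X
          high⇒∈ {v} hi = Vec.lookup⇒[]= v X (trans (Vec.lookup∘tabulate (λ v → does (high? v)) v) (dec-true (high? v) hi))
          ∉⇒low : ∀ {v} → v ∉ X → deg (R c) v < suc r
          ∉⇒low {v} v∉ with low? v
          ... | yes lo = lo
          ... | no hi  = contradiction (high⇒∈ hi) v∉
          ∣X∣≡K : ∣ X ∣ ≡ K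
          ∣X∣≡K = trans (∣∣≡count X) (trans (count-cong (_∈? X) high? (λ v → mk⇔ ∈⇒high high⇒∈)) y≡K)

-- From star-free colorings with many edges to the extremal family

neighbor⇒1≤deg : (G : Graph (Fin n)) → ∀ {u v} → Adj G u v → 1 ≤ deg G u
neighbor⇒1≤deg G {u} {v} a =
  injection⇒≤count (adj? G u) {λ (_ : Fin 1) → v} (λ { {zero} {zero} _ → refl }) (λ _ → a)

-- The case of a monochromatic missing star. For `k ≤ 3` the degree bound is met with equality up to
-- rounding; for `k ≥ 4` the two hypotheses on `H` contradict each other.
bounded⇒OtStar : ∀ k → 1 ≤ k → 4 * k ≤ n → (H : Graph (Fin n)) →
  (∀ v → deg H v < k) → otStar n k ≤ e H → OtStar n k H
bounded⇒OtStar 1 _ _ H small _ = record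
  { bij = ↔-id _
  ; adj = λ u v → mk⇔ (λ a → contradiction (≤-trans (neighbor⇒1≤deg H a) (≤-pred (small u))) λ ()) λ ()
  }
bounded⇒OtStar {n} 2 _ _ H small s≤e =
  matching⇒OtStar H (deg≤1⇒matching H (≤-pred ∘ small) (subst (λ m → m / 2 ≤ e H) (*-identityˡ n) s≤e))
bounded⇒OtStar {n} 3 _ _ H small s≤e = twoRegular⇒OtStar H (deg≡2⇒twoRegular H
  (sum-mono-tight (≤-pred ∘ small) (begin
    sum {n} (λ _ → 2)    ≡⟨ sum-const n 2 ⟩
    n * 2                ≡⟨ *-comm n 2 ⟩
    2 * n                ≤⟨ *-monoʳ-≤ 2 (subst (_≤ e H) (2*n/2≡n n) s≤e) ⟩
    2 * e H              ≡⟨ handshake H ⟩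
    sum (deg H)          ∎)))
  where open ≤-Reasoning
bounded⇒OtStar {suc M} (suc (suc (suc (suc j)))) _ 4k≤n H small s≤e = contradiction (begin-strict
    2 * s + K * K                              ≤⟨ +-monoˡ-≤ (K * K) (*-monoʳ-≤ 2 s≤e) ⟩
    2 * e H + K * K                            ≡⟨ cong (_+ K * K) (handshake H) ⟩
    sum (deg H) + K * K                        ≤⟨ +-monoˡ-≤ (K * K) (sum-mono (≤-pred ∘ small)) ⟩
    sum {suc M} (λ _ → suc K) + K * K          ≡⟨ cong (_+ K * K) (sum-const (suc M) (suc K)) ⟩
    suc M * suc K + K * K                      ≡⟨ rearrange j M ⟩
    -- The added polynomial completes the constant to `(K - 1)(4 k - 1)`, to which `4 k - 1 ≤ M`
    -- applies.
    K * M + M + (7 + 5 * j + j * j)            ≤⟨ +-monoʳ-≤ (K * M + M) (m≤m+n _ (8 + 14 * j + 3 * (j * j))) ⟩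
    K * M + M + (7 + 5 * j + j * j + (8 + 14 * j + 3 * (j * j)))
                                               ≡⟨ cong (K * M + M +_) (product j) ⟩
    K * M + M + (1 + j) * (15 + 4 * j)         ≤⟨ +-monoʳ-≤ (K * M + M) (*-monoʳ-≤ (1 + j) M≥) ⟩
    K * M + M + (1 + j) * M                    <⟨ m<m+n _ (s≤s z≤n) ⟩
    K * M + M + (1 + j) * M + K                ≡⟨ collect j M ⟩
    2 * (K * M) + K                            ≡⟨ otStar-doubled M j (≤-trans (m≤n*m (4 + j) 4) 4k≤n) ⟨
    2 * s + K * K                              ∎) (<-irrefl refl)
  where
  open ≤-Reasoning
  K = 2 + j
  s = otStar (suc M) (4 + j)
  M≥ : 15 + 4 * j ≤ M
  M≥ = ≤-pred (subst (_≤ suc M) (expand j) 4k≤n)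
    where
    expand : ∀ j → 4 * (4 + j) ≡ 16 + 4 * j
    expand = solve-∀
  rearrange : ∀ j M → suc M * suc (2 + j) + (2 + j) * (2 + j) ≡ (2 + j) * M + M + (7 + 5 * j + j * j)
  rearrange = solve-∀
  product : ∀ j → 7 + 5 * j + j * j + (8 + 14 * j + 3 * (j * j)) ≡ (1 + j) * (15 + 4 * j)
  product = solve-∀
  collect : ∀ j M → (2 + j) * M + M + (1 + j) * M + (2 + j) ≡ 2 * ((2 + j) * M) + (2 + j)
  collect = solve-∀
bounded⇒OtStar {zero} (suc (suc (suc (suc j)))) _ ()

-- Here `k = 2 + (r + b)`. `OtStar` is defined by cases on `k`, so `conclude` replaces `r + b` by a
-- variable to split on.
mixed⇒OtStar : ∀ {M} (c : Coloring (suc M)) r b (avoids : Avoids c (suc r) (suc b)) →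
  4 * (2 + (r + b)) ≤ suc M → Mixed.y c r b avoids ≤ Mixed.x c r b avoids →
  otStar (suc M) (2 + (r + b)) ≤ e (R c) → OtStar (suc M) (2 + (r + b)) (R c)
mixed⇒OtStar {M} c r b avoids 4k≤n y≤x s≤e = conclude (r + b) refl
  where
  open Mixed c r b avoids
  D : ℕ
  D = M ∸ suc (r + b)
  M≡ : M ≡ suc D + (r + b)
  M≡ = sym (trans (sym (+-suc D (r + b))) (m∸n+n≡m (≤-pred (≤-trans (m≤n*m (2 + (r + b)) 4) 4k≤n))))
  few-edges : ∀ K → r + b ≡ K → 2 * e (R c) + K * K ≤ 2 * (K * M) + K
  few-edges _ refl = ≤-trans (m≤m+n _ (slack y≤x {D} M≡)) (edges+slack≤ y≤x {D} M≡)
  conclude : ∀ K → r + b ≡ K → OtStar (suc M) (2 + K) (R c)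
  -- For `k = 2` the bound leaves no red edge, while `n / 2` is positive.
  conclude 0 K≡ = contradiction (begin-strict
      0                       <⟨ s≤s z≤n ⟩
      2                       ≤⟨ *-monoʳ-≤ 2 (/-monoˡ-≤ {2} {1 * suc M} 2 (≤-trans (s≤s (s≤s z≤n)) (≤-trans 4k≤n (≤-reflexive (sym (*-identityˡ (suc M))))))) ⟩
      2 * ((1 * suc M) / 2)   ≤⟨ *-monoʳ-≤ 2 (subst (λ K → otStar (suc M) (2 + K) ≤ e (R c)) K≡ s≤e) ⟩
      2 * e (R c)             ≡⟨ +-identityʳ _ ⟨
      2 * e (R c) + 0         ≤⟨ few-edges 0 K≡ ⟩
      0                       ∎) λ ()
    where open ≤-Reasoning
  -- For `k = 3` the bound gives at most `n - 1` red edges, one fewer than the `n` required.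
  conclude 1 K≡ = contradiction (begin-strict
      2 * e (R c)             <⟨ m<m+n _ (s≤s z≤n) ⟩
      2 * e (R c) + 1         ≤⟨ few-edges 1 K≡ ⟩
      2 * (1 * M) + 1         <⟨ n<1+n _ ⟩
      suc (2 * (1 * M) + 1)   ≡⟨ expand M ⟩
      2 * suc M               ≤⟨ *-monoʳ-≤ 2 (subst (_≤ e (R c)) (2*n/2≡n (suc M)) (subst (λ K → otStar (suc M) (2 + K) ≤ e (R c)) K≡ s≤e)) ⟩
      2 * e (R c)             ∎) (<-irrefl refl)
    where
    open ≤-Reasoning
    expand : ∀ M → suc (2 * (1 * M) + 1) ≡ 2 * suc M
    expand = solve-∀
  conclude (suc (suc j)) K≡ = subst₂ (λ p q → IsCompleteSplit p q (R c)) K≡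
    (trans (cong (suc M ∸_) K≡) (sym (split-size (suc M) j k≤n)))
    (isCompleteSplit y≤x {D} M≡ many)
    where
    k≤n : 4 + j ≤ suc M
    k≤n = subst (λ K → 2 + K ≤ suc M) K≡ (≤-trans (m≤n*m (2 + (r + b)) 4) 4k≤n)
    many : 2 * ((r + b) * M) + (r + b) ≤ 2 * e (R c) + (r + b) * (r + b)
    many = subst (λ K → otStar (suc M) (2 + K) ≤ e (R c) → 2 * (K * M) + K ≤ 2 * e (R c) + K * K) (sym K≡)
      (λ s≤ → ≤-trans (≤-reflexive (sym (otStar-doubled M j k≤n))) (+-monoˡ-≤ ((2 + j) * (2 + j)) (*-monoʳ-≤ 2 s≤))) s≤e

-- Swapping colors does not simply exchange `x` and `y`, because vertices within both bounds are low
-- on either side. But every high vertex becomes low, so the new `x` is at least the old `y`, and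
-- the new `y` at most the old `x`.
swapped-dominates : ∀ {M} (c : Coloring (suc M)) r b (avoids : Avoids c (suc r) (suc b)) →
  Mixed.x c r b avoids < Mixed.y c r b avoids →
  Mixed.y (swapColors c) b r (λ v → swap (avoids v)) ≤ Mixed.x (swapColors c) b r (λ v → swap (avoids v))
swapped-dominates c r b avoids x<y = ≤-trans (+-cancelˡ-≤ A.y S.y A.x (begin
    A.y + S.y    ≤⟨ +-monoˡ-≤ S.y y≤x′ ⟩
    S.x + S.y    ≡⟨ trans S.x+y≡N (sym A.x+y≡N) ⟩
    A.x + A.y    ≡⟨ +-comm A.x A.y ⟩
    A.y + A.x    ∎)) (≤-trans (<⇒≤ x<y) y≤x′)
  where
  open ≤-Reasoning
  module A = Mixed c r b avoids
  module S = Mixed (swapColors c) b r (λ v → swap (avoids v))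
  y≤x′ : A.y ≤ S.x
  y≤x′ = sum-mono λ v → 𝟙-mono (λ hi → [ (λ lo → contradiction lo hi) , id ]′ (avoids v)) (A.high? v) (S.low? v)

-- No degree is below 0, so `r = 0` or `b = 0` bounds all degrees of the other color. In the mixed
-- case the colors are swapped if high vertices are in the majority.
avoids⇒OtStar : (c : Coloring n) → 1 ≤ n → r + b ≡ k → 1 ≤ k → 4 * k ≤ n → Avoids c r b →
  otStar n k ≤ e (R c) → otStar n k ≤ e (B c) → OtStar n k (R c) ⊎ OtStar n k (B c)
avoids⇒OtStar {r = zero} {k = k} c _ refl 1≤k 4k≤n avoids _ s≤B =
  inj₂ (bounded⇒OtStar k 1≤k 4k≤n (B c) (λ v → [ (λ ()) , id ]′ (avoids v)) s≤B)
avoids⇒OtStar {r = suc r} {zero} {k} c _ r+0≡k 1≤k 4k≤n avoids s≤R _ =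
  inj₁ (bounded⇒OtStar k 1≤k 4k≤n (R c)
    (λ v → subst (deg (R c) v <_) (trans (sym (+-identityʳ (suc r))) r+0≡k) ([ id , (λ ()) ]′ (avoids v))) s≤R)
avoids⇒OtStar {suc M} {suc r} {suc b} c _ r+b≡k 1≤k 4k≤n avoids s≤R s≤B
  with refl ← trans (sym (cong suc (+-suc r b))) r+b≡k
  with Mixed.y c r b avoids ≤? Mixed.x c r b avoids
... | yes y≤x = inj₁ (mixed⇒OtStar c r b avoids 4k≤n y≤x s≤R)
... | no y≰x  = inj₂ (subst (λ K → OtStar (suc M) (2 + K) (B c)) (+-comm b r)
  (mixed⇒OtStar (swapColors c) b r (λ v → swap (avoids v))
    (subst (λ K → 4 * (2 + K) ≤ suc M) (+-comm r b) 4k≤n)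
    (swapped-dominates c r b avoids (≰⇒> y≰x))
    (subst (λ K → otStar (suc M) (2 + K) ≤ e (B c)) (+-comm r b) s≤B)))

-- Edge counts, missing stars and existence of the extremal graphs

emptyGraph-deg : ∀ n v → deg (emptyGraph n) v ≡ 0
emptyGraph-deg n v = count-∄ (adj? (emptyGraph n) v) λ _ ()

OtStar-e : ∀ k → 1 ≤ k → 4 * k ≤ n → (H : Graph (Fin n)) → OtStar n k H → e H ≡ otStar n k
OtStar-e {n} 1 _ _ H φ = trans (e-≅ φ) (m+n≡0⇒m≡0 (e (emptyGraph n)) (trans (handshake (emptyGraph n))
  (trans (sum-cong-≗ (emptyGraph-deg n)) (trans (sum-const n 0) (*-zeroʳ n)))))
OtStar-e {n} 2 _ _ H O = trans (matching⇒e≡n/2 H (OtStar⇒matching H O)) (cong (_/ 2) (sym (*-identityˡ n)))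
OtStar-e {n} 3 _ _ H O = trans (twoRegular⇒e≡n H (OtStar⇒twoRegular H O)) (sym (2*n/2≡n n))
OtStar-e {suc M} (suc (suc (suc (suc j)))) _ 4k≤n H O =
  *-cancelˡ-≡ (e H) (otStar (suc M) (4 + j)) 2 (+-cancelʳ-≡ ((2 + j) * (2 + j)) _ _
    (trans (split-edges H O refl) (sym (otStar-doubled M j (≤-trans (m≤n*m (4 + j) 4) 4k≤n)))))
OtStar-e {zero} (suc (suc (suc (suc j)))) _ ()

-- If H is one color class, n ≤ deg H v + b says that v has degree below b in the other.
OtStar-gap : ∀ k → 1 ≤ k → (H : Graph (Fin n)) → OtStar n k H →
  ∃[ r ] ∃[ b ] r + b ≡ k × (∀ v → deg H v < r ⊎ n ≤ deg H v + b)
OtStar-gap {n} 1 _ H φ = 1 , 0 , refl , λ v → inj₁ (s≤s (≤-reflexive (trans (deg-≅ φ v) (emptyGraph-deg n (Inverse.to (_≅_.bij φ) v)))))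
OtStar-gap 2 _ H O = 2 , 0 , refl , λ v → inj₁ (s≤s (matching⇒deg≤1 H (OtStar⇒matching H O) v))
OtStar-gap 3 _ H O = 3 , 0 , refl , λ v → inj₁ (s≤s (≤-reflexive (twoRegular⇒deg≡2 H (OtStar⇒twoRegular H O) v)))
-- The missing star has `k - 1` edges in the color of `H` and one in the other: clique vertices have
-- no edge of the other color, and all other vertices have degree `k - 2` in `H`.
OtStar-gap {n} (suc (suc (suc (suc j)))) _ H O = 3 + j , 1 , +-comm (3 + j) 1 , λ v →
  [ (λ d≡ → inj₂ (≤-reflexive (trans (sym d≡) (+-comm 1 (deg H v)))))
  , (λ d≡ → inj₁ (s≤s (≤-reflexive d≡)))
  ]′ (split-degrees H O v)

-- Supplies the coloring that proves minimality of `otStar n k`.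
OtStar-inhabited : ∀ k → 1 ≤ k → 4 * k ≤ n → ∃ (OtStar n k)
OtStar-inhabited {n} 1 _ _ = emptyGraph n , ≅-refl
OtStar-inhabited {n} 2 _ _ = partnerGraph n , matching⇒OtStar _ (partnerGraph-matching n)
OtStar-inhabited {n} 3 _ 4k≤n =
  cycle n , twoRegular⇒OtStar _ (cycle-twoRegular (≤-trans (s≤s (s≤s (s≤s z≤n))) 4k≤n))
OtStar-inhabited {n} (suc (suc (suc (suc j)))) _ 4k≤n =
  let X , ∣X∣≡ = subset-of-size (≤-trans (m≤n+m (2 + j) 2) k≤n)
  in splitGraph X , splitGraph-isCompleteSplit X ∣X∣≡ (sym (split-size n j k≤n))
  where
  k≤n : 4 + j ≤ n
  k≤n = ≤-trans (m≤n*m (4 + j) 4) 4k≤n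

-- A crude bound, enough to show that two classes of this size cannot fill the complete graph.
otStar≤ : ∀ n k → 1 ≤ k → otStar n k ≤ (k ∸ 1) * n
otStar≤ n 1 _ = z≤n
otStar≤ n 2 _ = m/n≤m (1 * n) 2
otStar≤ n 3 _ = m/n≤m (2 * n) 2
otStar≤ n (suc (suc (suc (suc j)))) _ = ≤-trans (m∸n≤m ((2 + j) * n) (((4 + j) * (4 + j) ∸ 3 * (4 + j) + 2) / 2)) (*-monoˡ-≤ n (n≤1+n (2 + j)))

complementColoring : Graph (Fin n) → Coloring n
complementColoring H = record
  { R        = H
  ; B        = record
    { Adj        = λ u v → u ≢ v × ¬ Adj H u v
    ; adj?       = λ u v → ¬? (u ≟ v) ×-dec ¬? (adj? H u v)
    ; adj-sym    = λ (u≢v , ¬a) → u≢v ∘ sym , ¬a ∘ adj-sym H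
    ; adj-irrefl = λ u≡v (u≢v , _) → u≢v u≡v
    }
  ; covers   = λ {u} {v} u≢v → map₂ (u≢v ,_) (toSum (adj? H u v))
  ; disjoint = λ a (_ , ¬a) → ¬a a
  }

edges-red+blue : (c : Coloring n) → 2 * (e (R c) + e (B c)) + n ≡ n * n
edges-red+blue {n} c = begin
  2 * (e (R c) + e (B c)) + n                            ≡⟨ cong (_+ n) (*-distribˡ-+ 2 (e (R c)) (e (B c))) ⟩
  2 * e (R c) + 2 * e (B c) + n                          ≡⟨ cong₂ (λ a b → a + b + n) (handshake (R c)) (handshake (B c)) ⟩
  sum (deg (R c)) + sum (deg (B c)) + n                  ≡⟨ cong₂ _+_ (∑-distrib-+ {n} (deg (R c)) (deg (B c))) (trans (sum-const n 1) (*-identityʳ n)) ⟨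
  sum {n} (λ v → deg (R c) v + deg (B c) v) + sum {n} (λ _ → 1)
    ≡⟨ ∑-distrib-+ {n} (λ v → deg (R c) v + deg (B c) v) (λ _ → 1) ⟨
  sum {n} (λ v → deg (R c) v + deg (B c) v + 1)          ≡⟨ sum-cong-≗ {n} (λ v → trans (+-comm _ 1) (deg-red+blue c v)) ⟩
  sum {n} (λ _ → n)                                      ≡⟨ sum-const n n ⟩
  n * n                                                  ∎
  where open ≡-Reasoning

-- The extremal number and the extremal family

module _ {n k : ℕ} (1≤n : 1 ≤ n) (1≤k : 1 ≤ k) (4k≤n : 4 * k ≤ n) where
  private
    s = otStar n k

  -- If both classes had at most `s` edges, then `n * n` would be at most `4 (k - 1) n + n`, which
  -- is less than `4 k n`. Hence a class of size `s` is the smaller one, and the other cannot belong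
  -- to the family.
  s<blue : (c : Coloring n) → e (R c) ≡ s → s < e (B c)
  s<blue c R≡s = ≰⇒> λ B≤s → contradiction (begin-strict
      n * n                              ≡⟨ edges-red+blue c ⟨
      2 * (e (R c) + e (B c)) + n        ≤⟨ +-monoˡ-≤ n (*-monoʳ-≤ 2 (+-mono-≤ (≤-reflexive R≡s) B≤s)) ⟩
      2 * (s + s) + n                    ≤⟨ +-monoˡ-≤ n (*-monoʳ-≤ 2 (+-mono-≤ (otStar≤ n k 1≤k) (otStar≤ n k 1≤k))) ⟩
      2 * (k′ * n + k′ * n) + n          <⟨ m<m+n _ (≤-trans 1≤n (m≤m+n n _)) ⟩
      2 * (k′ * n + k′ * n) + n + 3 * n  ≡⟨ collect k′ n ⟩
      4 * suc k′ * n                     ≡⟨ cong (λ k → 4 * k * n) (m+[n∸m]≡n 1≤k) ⟩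
      4 * k * n                          ≤⟨ *-monoˡ-≤ n 4k≤n ⟩
      n * n                              ∎) (<-irrefl refl)
    where
    open ≤-Reasoning
    k′ = k ∸ 1
    collect : ∀ a n → 2 * (a * n + a * n) + n + 3 * n ≡ 4 * suc a * n
    collect = solve-∀

  -- The weak inequality `s ≤` serves twice: strictly larger classes give the forcing property,
  -- equality gives the characterization of the family.
  missing⇒OtStar : (c : Coloring n) → r + b ≡ e (star k) → ¬ ColoredCopy r b (star k) c →
    s ≤ e (R c) ⊓ e (B c) → OtStar n k (R c) ⊎ OtStar n k (B c)
  missing⇒OtStar c r+b≡ ¬copy s≤ with copy⊎avoids c r+b≡
  ... | inj₁ copy   = contradiction copy ¬copy
  ... | inj₂ avoids = avoids⇒OtStar c 1≤n (trans r+b≡ (e-star k)) 1≤k 4k≤n avoids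
    (≤-trans s≤ (m⊓n≤m _ _)) (≤-trans s≤ (m⊓n≤n (e (R c)) _))

  OtStar⇒missing : (c : Coloring n) (H : Graph (Fin n)) → OtStar n k H → R c ≅ H ⊎ B c ≅ H →
    ∃[ r ] ∃[ b ] r + b ≡ e (star k) × ¬ ColoredCopy r b (star k) c
  OtStar⇒missing c H O R≅H⊎B≅H with r , b , r+b≡k , gap ← OtStar-gap k 1≤k H O with R≅H⊎B≅H
  ... | inj₁ φ = r , b , trans r+b≡k (sym (e-star k)) , avoids⇒¬copy {c = c} λ v →
    [ (λ d< → inj₁ (subst (_< r) (sym (deg-≅ φ v)) d<))
    , (λ n≤ → inj₂ (+-cancelˡ-≤ (deg (R c) v) _ _ (begin
        deg (R c) v + suc (deg (B c) v)    ≡⟨ +-suc (deg (R c) v) (deg (B c) v) ⟩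
        suc (deg (R c) v + deg (B c) v)    ≡⟨ deg-red+blue c v ⟩
        n                                  ≤⟨ n≤ ⟩
        deg H _ + b                        ≡⟨ cong (_+ b) (deg-≅ φ v) ⟨
        deg (R c) v + b                    ∎)))
    ]′ (gap (Inverse.to (_≅_.bij φ) v))
    where open ≤-Reasoning
  ... | inj₂ φ = b , r , trans (+-comm b r) (trans r+b≡k (sym (e-star k))) , avoids⇒¬copy {c = c} λ v →
    [ (λ d< → inj₂ (subst (_< r) (sym (deg-≅ φ v)) d<))
    , (λ n≤ → inj₁ (+-cancelʳ-≤ (deg (B c) v) _ _ (begin
        suc (deg (R c) v + deg (B c) v)    ≡⟨ deg-red+blue c v ⟩
        n                                  ≤⟨ n≤ ⟩
        deg H _ + b                        ≡⟨ cong (_+ b) (deg-≅ φ v) ⟨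
        deg (B c) v + b                    ≡⟨ +-comm (deg (B c) v) b ⟩
        b + deg (B c) v                    ∎)))
    ]′ (gap (Inverse.to (_≅_.bij φ) v))
    where open ≤-Reasoning

  min≡s : (c : Coloring n) → e (R c) ≡ s → e (R c) ⊓ e (B c) ≡ s
  min≡s c R≡s = trans (m≤n⇒m⊓n≡m (≤-trans (≤-reflexive R≡s) (<⇒≤ (s<blue c R≡s)))) R≡s

  -- Above the threshold a missing star would make one class a member of the family, which has only
  -- `s` edges. The complement coloring of any member shows that no smaller threshold works.
  isOt : IsOt n (star k) s
  isOt = forces , minimal
    where
    forces : Forces n (star k) s
    forces c s<min r b r+b≡ with copy⊎avoids c r+b≡
    ... | inj₁ copy   = copy
    ... | inj₂ avoids = contradiction s<min (≤⇒≯ ([ ≤-trans (m⊓n≤m _ _) ∘ e≤s (R c) , ≤-trans (m⊓n≤n (e (R c)) _) ∘ e≤s (B c) ]′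
      (missing⇒OtStar c r+b≡ (avoids⇒¬copy {c = c} avoids) (<⇒≤ s<min))))
      where
      e≤s : ∀ H → OtStar n k H → e H ≤ s
      e≤s H O = ≤-reflexive (OtStar-e k 1≤k 4k≤n H O)
    minimal : ∀ t → Forces n (star k) t → s ≤ t
    minimal t forces-t with H , O ← OtStar-inhabited k 1≤k 4k≤n = ≮⇒≥ λ t<s →
      let c = complementColoring H
          r , b , r+b≡ , ¬copy = OtStar⇒missing c H O (inj₁ ≅-refl)
      in ¬copy (forces-t c (subst (t <_) (sym (min≡s c (OtStar-e k 1≤k 4k≤n H O))) t<s) r b r+b≡)

  family⇔ : (F : Family n) → IsOtFamily n (star k) F ⇔ SameUpToIso F (OtStar n k)
  family⇔ F = mk⇔ forward backward
    where
    forward : IsOtFamily n (star k) F → SameUpToIso F (OtStar n k)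
    forward (s′ , (forces′ , minimal′) , e≡s′ , char) = F⊆O , O⊆F
      where
      s′≡s : s′ ≡ s
      s′≡s = ≤-antisym (minimal′ s (proj₁ isOt)) (proj₂ isOt s′ forces′)
      e≡s : ∀ H → F H → e H ≡ s
      e≡s H FH = trans (e≡s′ H FH) s′≡s
      F⊆O : ∀ H → F H → ∃[ H′ ] OtStar n k H′ × H ≅ H′
      F⊆O H FH = [ (λ O → H , O , ≅-refl)
                 -- Membership of the blue class would give it `s` edges, but it has more; so `H`
                 -- itself, the red class, is the member.
                 , (λ O → contradiction (OtStar-e k 1≤k 4k≤n (B c) O) (>⇒≢ (s<blue c (e≡s H FH)))) ]′
                 (missing⇒OtStar c (proj₁ missing) (proj₂ missing) (≤-reflexive (sym (min≡s c (e≡s H FH)))))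
        where
        c = complementColoring H
        missing = proj₂ (proj₂ (Equivalence.from (char c (trans (min≡s c (e≡s H FH)) (sym s′≡s))) (H , FH , inj₁ ≅-refl)))
      O⊆F : ∀ H → OtStar n k H → ∃[ H′ ] F H′ × H ≅ H′
      O⊆F H O = let H′ , FH′ , φ⊎φ = Equivalence.to (char c (trans (min≡s c e≡) (sym s′≡s))) (OtStar⇒missing c H O (inj₁ ≅-refl))
                in H′ , FH′ , [ id , (λ φ → contradiction (trans (e-≅ φ) (e≡s H′ FH′)) (>⇒≢ (s<blue c e≡))) ]′ φ⊎φ
        where
        c = complementColoring H
        e≡ = OtStar-e k 1≤k 4k≤n H O
    backward : SameUpToIso F (OtStar n k) → IsOtFamily n (star k) F
    backward (F⊆O , O⊆F) = s , isOt , e≡s , λ c min≡ → mk⇔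
        (λ (r , b , r+b≡ , ¬copy) → [ (λ O → let H , FH , φ = O⊆F (R c) O in H , FH , inj₁ φ)
                                    , (λ O → let H , FH , φ = O⊆F (B c) O in H , FH , inj₂ φ) ]′
                                    (missing⇒OtStar c r+b≡ ¬copy (≤-reflexive (sym min≡))))
        (λ (H , FH , φ⊎φ) → let H′ , O , ψ = F⊆O H FH in
          OtStar⇒missing c H′ O ([ (λ φ → inj₁ (≅-trans φ ψ)) , (λ φ → inj₂ (≅-trans φ ψ)) ]′ φ⊎φ))
      where
      e≡s : ∀ H → F H → e H ≡ s
      e≡s H FH = let H′ , O , φ = F⊆O H FH in trans (e-≅ φ) (OtStar-e k 1≤k 4k≤n H′ O)

theorem4p1 : (n k : ℕ) → 1 ≤ n → 1 ≤ k → 4 * k ≤ n →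
    IsOt n (star k) (otStar n k)
    × ((F : Family n) → IsOtFamily n (star k) F ⇔ SameUpToIso F (OtStar n k))
theorem4p1 n k 1≤n 1≤k 4k≤n = isOt 1≤n 1≤k 4k≤n , family⇔ 1≤n 1≤k 4k≤n
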